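{- Let $P_{(2,2)}$ be the set of all cylindric partitions with profile $c=(2,2)$. Then, as formal power series in $q$, $$\sum_{\Lambda\in P_{(2,2)}} q^{|\Lambda|}=\left(1+\sum_{n\ge1}\frac{2\,q^{n(n+1)}(-q^2;q^2)_{n-1}}{(q^2;q^2)_n\,(-q;q^2)_n}\right)\frac{(-q;q^2)_\infty}{(q;q)_\infty}.$$
   Context: Let $r,\ell$ be positive integers and $c=(c_1,\dots,c_r)$ a composition of $\ell$ into $r$ nonnegative integer parts (zero entries allowed). A cylindric partition with profile $c$ is a tuple $\Lambda=(\lambda^{(1)},\dots,\lambda^{(r)})$ of ordinary partitions $\lambda^{(i)}=(\lambda^{(i)}_1\ge\lambda^{(i)}_2\ge\cdots)$ (parts beyond the length are taken to be $0$) such that for all $i,j$: $\lambda^{(i)}_j\ge\lambda^{(i+1)}_{j+c_{i+1}}$ for $1\le i\le r-1$, and $\lambda^{(r)}_j\ge\lambda^{(1)}_{j+c_1}$. The size $|\Lambda|$ is the sum of all parts of all $\lambda^{(i)}$; the empty cylindric partition is included with size $0$. Notation: $(a;q)_n=\prod_{k=1}^n(1-aq^{k-1})$ (so $(a;q)_0=1$), $(a;q)_\infty=\lim_{n\to\infty}(a;q)_n$. -}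

module Defs where

open import Data.Nat using (ℕ; zero; suc; _≟_; _+_; _*_; _∸_; _≤_; _<_; _≥_)
open import Data.Nat.DivMod using (_%_; m%n<n)
open import Data.Integer as ℤ using (ℤ; +_; -_)
open import Data.Fin using (Fin; toℕ; fromℕ<)
open import Data.List using (List; []; _∷_)
open import Data.List.Relation.Unary.All using (All)
open import Data.List.Relation.Unary.Linked using (Linked)
open import Data.Vec using (Vec; lookup; toList)
open import Data.Product using (_×_)
open import Relation.Binary.PropositionalEquality using (_≡_)
open import Relation.Nullary using (yes; no)

IsPartition : List ℕ → Set
IsPartition λs = Linked _≥_ λs × All (0 <_) λs

part : List ℕ → ℕ → ℕ
part []       _       = 0
part (x ∷ xs) zero    = x
part (x ∷ xs) (suc j) = part xs j

sumList : List ℕ → ℕ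
sumList []       = 0
sumList (x ∷ xs) = x + sumList xs

next : ∀ {k} → Fin (suc k) → Fin (suc k)
next {k} i = fromℕ< (m%n<n (suc (toℕ i)) (suc k))

IsCylindric : ∀ {k} → Vec ℕ (suc k) → Vec (List ℕ) (suc k) → Set
IsCylindric {k} c Λ =
  ((i : Fin (suc k)) → IsPartition (lookup Λ i)) ×
  ((i : Fin (suc k)) (j : ℕ) →
     part (lookup Λ (next i)) (j + lookup c (next i)) ≤ part (lookup Λ i) j)

size : ∀ {r} → Vec (List ℕ) r → ℕ
size Λ = sumVec (toList Λ)
  where
  sumVec : List (List ℕ) → ℕ
  sumVec []       = 0
  sumVec (l ∷ ls) = sumList l + sumVec ls

Series : Set
Series = ℕ → ℤ

sumTo : ℕ → (ℕ → ℤ) → ℤ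
sumTo zero    f = f 0
sumTo (suc n) f = sumTo n f ℤ.+ f (suc n)

_⊕_ : Series → Series → Series
(f ⊕ g) n = f n ℤ.+ g n

_⊖_ : Series → Series → Series
(f ⊖ g) n = f n ℤ.- g n

_⊛_ : Series → Series → Series
(f ⊛ g) n = sumTo n (λ i → f i ℤ.* g (n ∸ i))

mono : ℤ → ℕ → Series
mono a k n with k ≟ n
... | yes _ = a
... | no  _ = + 0

one : Series
one = mono (+ 1) 0

pow : Series → ℕ → Series
pow g zero    = one
pow g (suc k) = g ⊛ pow g k

-- Multiplicative inverse of a series f with constant term 1:
-- writing f = 1 - g (g has zero constant term), 1/f = Σ_k g^k, and only
-- k ≤ n contributes to the coefficient of q^n.
inv : Series → Series
inv f n = sumTo n (λ k → pow (one ⊖ f) k n)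

prodTo : ℕ → (ℕ → Series) → Series
prodTo zero    F = one
prodTo (suc n) F = prodTo n F ⊛ F n

-- q-Pochhammer (ε q^s ; q^t)_n = ∏_{m=0}^{n-1} (1 - ε q^{s + t m}),
-- e.g. (q^2;q^2)_n = poch (+ 1) 2 2 n,  (-q;q^2)_n = poch (- + 1) 1 2 n.
poch : ℤ → ℕ → ℕ → ℕ → Series
poch ε s t n = prodTo n (λ m → one ⊖ mono ε (s + t * m))

-- (ε q^s ; q^t)_∞ for t ≥ 1: the q-adic limit of the finite products.
-- Factors with index m ≥ n+1 are ≡ 1 mod q^{n+1}, so the coefficient of
-- q^n of the limit is that of the (n+1)-fold finite product.
pochInf : ℤ → ℕ → ℕ → Series
pochInf ε s t n = poch ε s t (suc n) n

summand : ℕ → Series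
summand n = mono (+ 2) (n * (n + 1)) ⊛ (poch (- + 1) 2 2 (n ∸ 1)
            ⊛ inv (poch (+ 1) 2 2 n ⊛ poch (- + 1) 1 2 n))

-- 1 + Σ_{n≥1} summand n.  The summand for n has valuation ≥ n(n+1) ≥ n,
-- so only n ≤ N contributes to the coefficient of q^N.
bracket : Series
bracket N = one N ℤ.+ sumTo N (λ n → if0 n (summand n N))
  where
  if0 : ℕ → ℤ → ℤ
  if0 zero    _ = + 0
  if0 (suc _) z = z

rhs : Series
rhs = bracket ⊛ (pochInf (- + 1) 1 2 ⊛ inv (pochInf (+ 1) 1 1))

{-# OPTIONS --safe #-}

-- Weighting a cylindric partition Λ by q^(|Λ| + c·max Λ) gives a series F₂₂(c); let F₄₀(c) be its
-- restriction to the Λ whose first partition contains a largest part.  With v = q^(c+1) and u = q^(c+2),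
-- removing the first parts gives
--   F₄₀(c) = (F₂₂(c+2) + u F₄₀(c+2)) / ((1-u)(1-v)),   F₂₂(c) = (1+v) F₄₀(c) + u F₄₀(c+2) / (1-u).
-- The solution is F₂₂ = g C, F₄₀ = h C with C(c) = (-q^(c+1);q²)_∞ / (q^(c+1);q)_∞, where the terms
--   g_n = 2 q^(n(n+1)+cn) (-q²;q²)_{n-1} / ((q²;q²)_n (-q^(c+1);q²)_n) for n ≥ 1,  g_0 = 1,
--   h_n = q^(n(n+1)+cn) (-q²;q²)_n / ((q²;q²)_n (-q^(c+1);q²)_{n+1})
-- of g and h satisfy the resulting equations one by one:
--   (1+v) h_n(c) = g_n(c+2) + u h_{n-1}(c+2),   (1+v) g_n(c) = (1+v) g_n(c+2) + 2u h_{n-1}(c+2).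
-- The coefficients of q^n with n < c are those of 1 on both sides, so c ↦ c+2 is a terminating induction,
-- and the theorem is the case c = 0.

module Submission where

open import Defs
open import Data.Nat using (ℕ)
open import Data.Integer using (+_)
open import Data.List using (List; []; _∷_; length)
open import Data.Vec using (Vec; []; _∷_)
open import Data.List.Membership.Propositional using (_∈_)
open import Data.List.Relation.Unary.Unique.Propositional using (Unique)
open import Data.Product using (_×_; ∃-syntax)
open import Function.Bundles using (_⇔_)
open import Relation.Binary.PropositionalEquality using (_≡_)

open import Algebra.Bundles using (CommutativeRing)
import Algebra.Solver.Ring
open import Algebra.Solver.Ring.AlmostCommutativeRing using (fromCommutativeRing; _-Raw-AlmostCommutative⟶_)
open import Data.Empty using (⊥-elim)
open import Data.Fin using (zero; suc)
open import Data.Integer as ℤ using (ℤ; -_)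
import Data.Integer.Properties as ℤP
import Data.Integer.Solver as ℤSolver
open import Data.List using (map; _++_)
open import Data.List.Membership.Propositional.Properties using (∈-map⁺; ∈-map⁻; ∈-++⁺ˡ; ∈-++⁺ʳ; ∈-++⁻)
open import Data.List.Properties using (length-map; length-++)
open import Data.List.Relation.Unary.All as All using ([]; _∷_)
import Data.List.Relation.Unary.All.Properties as AllP
open import Data.List.Relation.Unary.Any using (here; there)
open import Data.List.Relation.Unary.Linked using ([]; [-]; _∷_)
open import Data.List.Relation.Unary.Unique.Propositional using ([]; _∷_)
import Data.List.Relation.Unary.Unique.Propositional.Properties as Uniq
open import Data.Maybe using (Maybe; just; nothing)
open import Data.Nat using (zero; suc; _≟_; _+_; _*_; _∸_; _⊔_; _≤_; _<_; _<?_; z≤n; s≤s)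
open import Data.Nat.Properties
import Data.Nat.Solver as ℕSolver
open import Data.Product using (_,_; proj₁; proj₂; swap)
open import Data.Sum using (_⊎_; inj₁; inj₂; [_,_]′)
open import Function using (_∘_)
open import Function.Bundles using (mk⇔; Equivalence)
open import Relation.Binary.PropositionalEquality using (_≢_; refl; sym; trans; cong; cong₂; subst; module ≡-Reasoning)
open import Relation.Nullary using (¬_; yes; no)

-- Rearrangements of sums, exponents and weights.

+-interchange : ∀ a b c d → (a ℤ.+ b) ℤ.+ (c ℤ.+ d) ≡ (a ℤ.+ c) ℤ.+ (b ℤ.+ d)
+-interchange = solve 4 (λ a b c d → (a :+ b) :+ (c :+ d) := (a :+ c) :+ (b :+ d)) refl
  where open ℤSolver.+-*-Solver

exponent-c : ∀ c m → suc m * (suc m + 1) + (2 + c) * suc m ≡ suc m * (suc m + 1) + c * suc m + (2 + 2 * m)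
exponent-c = solve 2 (λ c m →
  (con 1 :+ m) :* (con 1 :+ m :+ con 1) :+ (con 2 :+ c) :* (con 1 :+ m) :=
  (con 1 :+ m) :* (con 1 :+ m :+ con 1) :+ c :* (con 1 :+ m) :+ (con 2 :+ con 2 :* m)) refl
  where open ℕSolver.+-*-Solver

exponent-m : ∀ c m → suc m * (suc m + 1) + c * suc m ≡ 2 + c + (m * (m + 1) + (2 + c) * m)
exponent-m = solve 2 (λ c m →
  (con 1 :+ m) :* (con 1 :+ m :+ con 1) :+ c :* (con 1 :+ m) :=
  con 2 :+ c :+ (m :* (m :+ con 1) :+ (con 2 :+ c) :* m)) refl
  where open ℕSolver.+-*-Solver

weight-addFirst : ∀ c x a b → suc c * x + (a + b) ≡ c * x + ((x + a) + b)
weight-addFirst = solve 4 (λ c x a b → (con 1 :+ c) :* x :+ (a :+ b) := c :* x :+ ((x :+ a) :+ b)) refl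
  where open ℕSolver.+-*-Solver

weight-edge-≤ : ∀ c m a b → (2 + c) * m + (a + b) ≡ (1 + c) * m + (a + (m + b))
weight-edge-≤ = solve 4 (λ c x a b → (con 2 :+ c) :* x :+ (a :+ b) := (con 1 :+ c) :* x :+ (a :+ (x :+ b))) refl
  where open ℕSolver.+-*-Solver

weight-edge-> : ∀ c m x a b → (2 + c) * m + ((x + a) + b) ≡ (1 + c) * m + ((m + a) + (x + b))
weight-edge-> = solve 5 (λ c m x a b → (con 2 :+ c) :* m :+ ((x :+ a) :+ b) :=
  (con 1 :+ c) :* m :+ ((m :+ a) :+ (x :+ b))) refl
  where open ℕSolver.+-*-Solver

-- Finite sums of integers.

sumTo-cong : ∀ n {f g} → (∀ i → i ≤ n → f i ≡ g i) → sumTo n f ≡ sumTo n g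
sumTo-cong zero    f≡g = f≡g 0 z≤n
sumTo-cong (suc n) f≡g =
  cong₂ ℤ._+_ (sumTo-cong n (λ i i≤n → f≡g i (m≤n⇒m≤1+n i≤n))) (f≡g (suc n) ≤-refl)

sumTo-0 : ∀ n {f} → (∀ i → i ≤ n → f i ≡ + 0) → sumTo n f ≡ + 0
sumTo-0 zero    f≡0 = f≡0 0 z≤n
sumTo-0 (suc n) f≡0 =
  cong₂ ℤ._+_ (sumTo-0 n (λ i i≤n → f≡0 i (m≤n⇒m≤1+n i≤n))) (f≡0 (suc n) ≤-refl)

sumTo-suc : ∀ n f → sumTo (suc n) f ≡ f 0 ℤ.+ sumTo n (f ∘ suc)
sumTo-suc zero    f = refl
sumTo-suc (suc n) f =
  trans (cong (ℤ._+ f (suc (suc n))) (sumTo-suc n f)) (ℤP.+-assoc (f 0) _ _)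

sumTo-+ : ∀ n f g → sumTo n (λ i → f i ℤ.+ g i) ≡ sumTo n f ℤ.+ sumTo n g
sumTo-+ zero    f g = refl
sumTo-+ (suc n) f g =
  trans (cong (ℤ._+ (f (suc n) ℤ.+ g (suc n))) (sumTo-+ n f g)) (+-interchange (sumTo n f) _ _ _)

sumTo-*ˡ : ∀ n a f → sumTo n (λ i → a ℤ.* f i) ≡ a ℤ.* sumTo n f
sumTo-*ˡ zero    a f = refl
sumTo-*ˡ (suc n) a f =
  trans (cong (ℤ._+ (a ℤ.* f (suc n))) (sumTo-*ˡ n a f)) (sym (ℤP.*-distribˡ-+ a _ _))

-- The commutative ring of formal power series.

-- Equality is wrapped in a record so that Agda can infer the two series from it.
infix 4 _≈_
record _≈_ (f g : Series) : Set where
  constructor mk≈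
  field at : ∀ n → f n ≡ g n
open _≈_

zeroS : Series
zeroS _ = + 0

neg : Series → Series
neg f n = - f n

⊛-suc : ∀ f g n → (f ⊛ g) (suc n) ≡ f 0 ℤ.* g (suc n) ℤ.+ ((f ∘ suc) ⊛ g) n
⊛-suc f g n = sumTo-suc n (λ i → f i ℤ.* g (suc n ∸ i))

⊛-sucʳ : ∀ f g n → (f ⊛ g) (suc n) ≡ f (suc n) ℤ.* g 0 ℤ.+ (f ⊛ (g ∘ suc)) n
⊛-sucʳ f g n = trans
  (cong₂ ℤ._+_
    (sumTo-cong n (λ i i≤n → cong (λ k → f i ℤ.* g k) (+-∸-assoc 1 i≤n)))
    (cong (λ k → f (suc n) ℤ.* g k) (n∸n≡0 n)))
  (ℤP.+-comm ((f ⊛ (g ∘ suc)) n) _)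

⊛-cong-at : ∀ n {f f′ g g′} → (∀ i → i ≤ n → f i ≡ f′ i) → (∀ i → i ≤ n → g i ≡ g′ i) →
            (f ⊛ g) n ≡ (f′ ⊛ g′) n
⊛-cong-at n f≡ g≡ = sumTo-cong n (λ i i≤n → cong₂ ℤ._*_ (f≡ i i≤n) (g≡ (n ∸ i) (m∸n≤m n i)))

⊛-distribʳ-at : ∀ h f g n → ((f ⊕ g) ⊛ h) n ≡ (f ⊛ h) n ℤ.+ (g ⊛ h) n
⊛-distribʳ-at h f g n = trans
  (sumTo-cong n (λ i _ → ℤP.*-distribʳ-+ (h (n ∸ i)) (f i) (g i)))
  (sumTo-+ n (λ i → f i ℤ.* h (n ∸ i)) _)

⊛-scaleˡ : ∀ a f g n → ((λ i → a ℤ.* f i) ⊛ g) n ≡ a ℤ.* (f ⊛ g) n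
⊛-scaleˡ a f g n = trans
  (sumTo-cong n (λ i _ → ℤP.*-assoc a (f i) (g (n ∸ i))))
  (sumTo-*ˡ n a (λ i → f i ℤ.* g (n ∸ i)))

-- Peeling the constant term of `f` off the left factor on one side and off the right factor on the
-- other leaves the same product one degree lower.
⊛-comm-at : ∀ n f g → (f ⊛ g) n ≡ (g ⊛ f) n
⊛-comm-at zero    f g = ℤP.*-comm (f 0) (g 0)
⊛-comm-at (suc n) f g = trans (⊛-suc f g n) (trans
  (cong₂ ℤ._+_ (ℤP.*-comm (f 0) (g (suc n))) (⊛-comm-at n (f ∘ suc) g))
  (sym (⊛-sucʳ g f n)))

-- Split `f` as its constant term plus q times `f ∘ suc`. The constant acts as a scalar on both
-- sides, and induction on the degree handles the rest.
⊛-assoc-at : ∀ n f g h → ((f ⊛ g) ⊛ h) n ≡ (f ⊛ (g ⊛ h)) n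
⊛-assoc-at zero    f g h = ℤP.*-assoc (f 0) (g 0) (h 0)
⊛-assoc-at (suc n) f g h = begin
  ((f ⊛ g) ⊛ h) (suc n)
    ≡⟨ ⊛-suc (f ⊛ g) h n ⟩
  (f 0 ℤ.* g 0) ℤ.* h (suc n) ℤ.+ (((f ⊛ g) ∘ suc) ⊛ h) n
    ≡⟨ cong (λ z → f0g0h ℤ.+ z) (trans
         (⊛-cong-at n {g = h} (λ i _ → ⊛-suc f g i) (λ _ _ → refl))
         (⊛-distribʳ-at h (λ i → f 0 ℤ.* g (suc i)) ((f ∘ suc) ⊛ g) n)) ⟩
  f0g0h ℤ.+ (((λ i → f 0 ℤ.* g (suc i)) ⊛ h) n ℤ.+ (((f ∘ suc) ⊛ g) ⊛ h) n)
    ≡⟨ cong (λ z → f0g0h ℤ.+ z) (cong₂ ℤ._+_ (⊛-scaleˡ (f 0) (g ∘ suc) h n) (⊛-assoc-at n (f ∘ suc) g h)) ⟩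
  f0g0h ℤ.+ (f 0 ℤ.* ((g ∘ suc) ⊛ h) n ℤ.+ rest)
    ≡⟨ sym (ℤP.+-assoc f0g0h _ _) ⟩
  (f0g0h ℤ.+ f 0 ℤ.* ((g ∘ suc) ⊛ h) n) ℤ.+ rest
    ≡⟨ cong (λ z → (z ℤ.+ f 0 ℤ.* ((g ∘ suc) ⊛ h) n) ℤ.+ rest) (ℤP.*-assoc (f 0) (g 0) (h (suc n))) ⟩
  (f 0 ℤ.* (g 0 ℤ.* h (suc n)) ℤ.+ f 0 ℤ.* ((g ∘ suc) ⊛ h) n) ℤ.+ rest
    ≡⟨ cong (ℤ._+ rest) (trans (sym (ℤP.*-distribˡ-+ (f 0) _ _)) (cong (λ z → f 0 ℤ.* z) (sym (⊛-suc g h n)))) ⟩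
  f 0 ℤ.* (g ⊛ h) (suc n) ℤ.+ rest
    ≡⟨ sym (⊛-suc f (g ⊛ h) n) ⟩
  (f ⊛ (g ⊛ h)) (suc n) ∎
  where
  open ≡-Reasoning
  f0g0h = (f 0 ℤ.* g 0) ℤ.* h (suc n)
  rest  = ((f ∘ suc) ⊛ (g ⊛ h)) n

mono-hit : ∀ a k → mono a k k ≡ a
mono-hit a k with k ≟ k
... | yes _  = refl
... | no k≢k = ⊥-elim (k≢k refl)

mono-miss : ∀ a {k n} → k ≢ n → mono a k n ≡ + 0
mono-miss a {k} {n} k≢n with k ≟ n
... | yes k≡n = ⊥-elim (k≢n k≡n)
... | no _    = refl

mono-suc : ∀ a k n → mono a (suc k) (suc n) ≡ mono a k n
mono-suc a k n with k ≟ n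
... | yes refl = mono-hit a (suc n)
... | no k≢n   = mono-miss a (k≢n ∘ suc-injective)

zeroˡ-at : ∀ g n {f} → (∀ i → f i ≡ + 0) → (f ⊛ g) n ≡ + 0
zeroˡ-at g n f≡0 = sumTo-0 n (λ i _ → cong (ℤ._* g (n ∸ i)) (f≡0 i))

mono0-⊛ : ∀ a f n → (mono a 0 ⊛ f) n ≡ a ℤ.* f n
mono0-⊛ a f zero    = refl
mono0-⊛ a f (suc n) = trans (⊛-suc (mono a 0) f n) (trans
  (cong (λ z → a ℤ.* f (suc n) ℤ.+ z) (zeroˡ-at f n (λ i → mono-miss a {0} {suc i} λ ())))
  (ℤP.+-identityʳ _))

mono-⊛ : ∀ a k f n → (mono a k ⊛ f) (k + n) ≡ a ℤ.* f n
mono-⊛ a zero    f n = mono0-⊛ a f n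
mono-⊛ a (suc k) f n = trans (⊛-suc (mono a (suc k)) f (k + n)) (trans
  (cong₂ ℤ._+_ (cong (ℤ._* f (suc (k + n))) (mono-miss a {suc k} {0} λ ()))
     (⊛-cong-at (k + n) {g = f} (λ i _ → mono-suc a k i) (λ _ _ → refl)))
  (trans (ℤP.+-identityˡ _) (mono-⊛ a k f n)))

≈-refl : ∀ {f} → f ≈ f
≈-refl .at n = refl

≈-sym : ∀ {f g} → f ≈ g → g ≈ f
≈-sym e .at n = sym (e .at n)

≈-trans : ∀ {f g h} → f ≈ g → g ≈ h → f ≈ h
≈-trans e e′ .at n = trans (e .at n) (e′ .at n)

⊛-cong : ∀ {f f′ g g′} → f ≈ f′ → g ≈ g′ → f ⊛ g ≈ f′ ⊛ g′
⊛-cong e e′ .at n = ⊛-cong-at n (λ i _ → e .at i) (λ i _ → e′ .at i)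

⊛-distribʳ : ∀ h f g → (f ⊕ g) ⊛ h ≈ (f ⊛ h) ⊕ (g ⊛ h)
⊛-distribʳ h f g .at = ⊛-distribʳ-at h f g

⊛-comm : ∀ f g → f ⊛ g ≈ g ⊛ f
⊛-comm f g .at n = ⊛-comm-at n f g

⊛-identityˡ : ∀ f → one ⊛ f ≈ f
⊛-identityˡ f .at n = trans (mono0-⊛ (+ 1) f n) (ℤP.*-identityˡ (f n))

⊕-cong : ∀ {f f′ g g′} → f ≈ f′ → g ≈ g′ → f ⊕ g ≈ f′ ⊕ g′
⊕-cong e e′ .at n = cong₂ ℤ._+_ (e .at n) (e′ .at n)

seriesRing : CommutativeRing _ _
seriesRing = record
  { Carrier = Series ; _≈_ = _≈_ ; _+_ = _⊕_ ; _*_ = _⊛_ ; -_ = neg ; 0# = zeroS ; 1# = one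
  ; isCommutativeRing = record
    { isRing = record
      { +-isAbelianGroup = record
        { isGroup = record
          { isMonoid = record
            { isSemigroup = record
              { isMagma = record
                { isEquivalence = record { refl = ≈-refl ; sym = ≈-sym ; trans = ≈-trans }
                ; ∙-cong = ⊕-cong }
              ; assoc = λ f g h → mk≈ λ n → ℤP.+-assoc (f n) (g n) (h n) }
            ; identity = (λ f → mk≈ λ n → ℤP.+-identityˡ (f n)) , (λ f → mk≈ λ n → ℤP.+-identityʳ (f n)) }
          ; inverse = (λ f → mk≈ λ n → ℤP.+-inverseˡ (f n)) , (λ f → mk≈ λ n → ℤP.+-inverseʳ (f n))
          ; ⁻¹-cong = λ e → mk≈ λ n → cong -_ (e .at n) }
        ; comm = λ f g → mk≈ λ n → ℤP.+-comm (f n) (g n) }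
      ; *-cong = ⊛-cong
      ; *-assoc = λ f g h → mk≈ λ n → ⊛-assoc-at n f g h
      ; *-identity = ⊛-identityˡ , λ f → ≈-trans (⊛-comm f one) (⊛-identityˡ f)
      ; distrib = (λ h f g → ≈-trans (⊛-comm h (f ⊕ g)) (≈-trans (⊛-distribʳ h f g) (⊕-cong (⊛-comm f h) (⊛-comm g h))))
                , ⊛-distribʳ }
    ; *-comm = ⊛-comm } }

-- Integers enter the ring solver as constant series, so `con (+ 1)` denotes `one` and `con (+ 2)`
-- denotes `mono (+ 2) 0`.
constant : CommutativeRing.rawRing ℤP.+-*-commutativeRing
           -Raw-AlmostCommutative⟶ fromCommutativeRing seriesRing
constant = record
  { ⟦_⟧ = λ a → mono a 0
  ; +-homo = λ a b → mk≈ λ { zero → refl ; (suc n) → refl }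
  ; *-homo = λ a b → mk≈ λ n → sym (trans (mono0-⊛ a (mono b 0) n) (scale a b n))
  ; -‿homo = λ a → mk≈ λ { zero → refl ; (suc n) → refl }
  ; 0-homo = mk≈ λ { zero → refl ; (suc n) → refl }
  ; 1-homo = ≈-refl }
  where
  scale : ∀ a b n → a ℤ.* mono b 0 n ≡ mono (a ℤ.* b) 0 n
  scale a b zero    = refl
  scale a b (suc n) = ℤP.*-zeroʳ a

constant≟ : ∀ a b → Maybe (mono a 0 ≈ mono b 0)
constant≟ a b with a ℤP.≟ b
... | yes refl = just ≈-refl
... | no _     = nothing

module SeriesSolver = Algebra.Solver.Ring
  (CommutativeRing.rawRing ℤP.+-*-commutativeRing) (fromCommutativeRing seriesRing) constant constant≟

open SeriesSolver using (solve; _:=_; _:+_; _:*_; _:-_; con)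
open import Relation.Binary.Reasoning.Setoid (CommutativeRing.setoid seriesRing)

≡⇒≈ : ∀ {f g : Series} → f ≡ g → f ≈ g
≡⇒≈ refl = ≈-refl

⊛-congˡ : ∀ h {f g} → f ≈ g → h ⊛ f ≈ h ⊛ g
⊛-congˡ h e = ⊛-cong (≈-refl {h}) e

⊛-congʳ : ∀ h {f g} → f ≈ g → f ⊛ h ≈ g ⊛ h
⊛-congʳ h e = ⊛-cong e (≈-refl {h})

-- Orders of vanishing

Vanishes< : ℕ → Series → Set
Vanishes< m f = ∀ n → n < m → f n ≡ + 0

-- If i + j = n < a + b, then i < a or j < b, so each summand of the Cauchy product has a zero
-- factor.
vanishes<-⊛ : ∀ a b {f g} → Vanishes< a f → Vanishes< b g → Vanishes< (a + b) (f ⊛ g)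
vanishes<-⊛ a b {f} {g} vf vg n n<a+b = sumTo-0 n term
  where
  term : ∀ i → i ≤ n → f i ℤ.* g (n ∸ i) ≡ + 0
  term i i≤n with i <? a
  ... | yes i<a = cong (ℤ._* g (n ∸ i)) (vf i i<a)
  ... | no i≮a  = trans (cong (λ z → f i ℤ.* z) (vg (n ∸ i) n∸i<b)) (ℤP.*-zeroʳ (f i))
    where
    n∸i<b : n ∸ i < b
    n∸i<b = +-cancelˡ-< i _ _ (≤-trans
      (≤-reflexive (cong suc (m+[n∸m]≡n i≤n)))
      (≤-trans n<a+b (+-monoˡ-≤ b (≮⇒≥ i≮a))))

vanishes<-⊛ˡ : ∀ a {f} g → Vanishes< a f → Vanishes< a (f ⊛ g)
vanishes<-⊛ˡ a g vf n n<a =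
  vanishes<-⊛ a 0 {g = g} vf (λ _ ()) n (≤-trans n<a (m≤m+n a 0))

vanishes<-mono : ∀ a {k m} → m ≤ k → Vanishes< m (mono a k)
vanishes<-mono a m≤k n n<m = mono-miss a (λ k≡n → <⇒≢ (<-≤-trans n<m m≤k) (sym k≡n))

-- Limits

infix 4 _⟶_
-- q-adic convergence with a fixed rate: the K-th series agrees with the limit modulo q^(K+1). The
-- uniform rate makes sums, products and index shifts immediate.
record _⟶_ (F : ℕ → Series) (f : Series) : Set where
  constructor mk⟶
  field stable : ∀ K n → n ≤ K → F K n ≡ f n
open _⟶_

⟶-const : ∀ {f} → (λ _ → f) ⟶ f
⟶-const .stable _ _ _ = refl

⟶-⊕ : ∀ {F G f g} → F ⟶ f → G ⟶ g → (λ K → F K ⊕ G K) ⟶ f ⊕ g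
⟶-⊕ l l′ .stable K n n≤K = cong₂ ℤ._+_ (l .stable K n n≤K) (l′ .stable K n n≤K)

⟶-⊛ : ∀ {F G f g} → F ⟶ f → G ⟶ g → (λ K → F K ⊛ G K) ⟶ f ⊛ g
⟶-⊛ l l′ .stable K n n≤K = ⊛-cong-at n
  (λ i i≤n → l .stable K i (≤-trans i≤n n≤K)) (λ i i≤n → l′ .stable K i (≤-trans i≤n n≤K))

⟶-suc : ∀ {F f} → F ⟶ f → (F ∘ suc) ⟶ f
⟶-suc l .stable K n n≤K = l .stable (suc K) n (m≤n⇒m≤1+n n≤K)

⟶-unique : ∀ {F G f g} → F ⟶ f → G ⟶ g → (∀ K → F K ≈ G K) → f ≈ g
⟶-unique l l′ e .at n =
  trans (sym (l .stable n n ≤-refl)) (trans (e n .at n) (l′ .stable n n ≤-refl))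

-- The diagonal value `F n n` is the form in which `inv` and the infinite sums truncate their
-- limits.
stabilise : ∀ {F : ℕ → Series} → (∀ K n → n ≤ K → F (suc K) n ≡ F K n) →
            ∀ K n → n ≤ K → F K n ≡ F n n
stabilise step zero    .zero z≤n = refl
stabilise step (suc K) n n≤1+K with m≤n⇒m<n∨m≡n n≤1+K
... | inj₁ (s≤s n≤K) = trans (step K n n≤K) (stabilise step K n n≤K)
... | inj₂ refl      = refl

∑≤ : (ℕ → Series) → ℕ → Series
∑≤ F zero    = F 0
∑≤ F (suc K) = ∑≤ F K ⊕ F (suc K)

-- Truncated exactly as `inv` is, so that `inv f` is by definition `∑∞ (pow (one ⊖ f))`. It is the
-- true infinite sum when the n-th term vanishes below q^n.
∑∞ : (ℕ → Series) → Series
∑∞ F N = sumTo N (λ n → F n N)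

∑≤-sumTo : ∀ F K n → ∑≤ F K n ≡ sumTo K (λ k → F k n)
∑≤-sumTo F zero    n = refl
∑≤-sumTo F (suc K) n = cong (ℤ._+ F (suc K) n) (∑≤-sumTo F K n)

∑≤⟶∑∞ : ∀ F → (∀ n → Vanishes< n (F n)) → ∑≤ F ⟶ ∑∞ F
∑≤⟶∑∞ F v .stable K n n≤K = trans
  (stabilise {∑≤ F} (λ K n n≤K → trans
    (cong (λ z → ∑≤ F K n ℤ.+ z) (v (suc K) n (s≤s n≤K))) (ℤP.+-identityʳ _)) K n n≤K)
  (∑≤-sumTo F n n)

-- Inverses

vanishes<-pow : ∀ {g} → g 0 ≡ + 0 → ∀ k → Vanishes< k (pow g k)
vanishes<-pow g0 zero    n ()
vanishes<-pow {g} g0 (suc k) = vanishes<-⊛ 1 k v₁ (vanishes<-pow g0 k)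
  where
  v₁ : Vanishes< 1 g
  v₁ zero    _ = g0
  v₁ (suc n) (s≤s ())

-- Telescoping: multiplying (1 - f)^k by f gives (1 - f)^k - (1 - f)^(k+1).
geometric : ∀ f K → (f ⊛ ∑≤ (pow (one ⊖ f)) K) ⊕ pow (one ⊖ f) (suc K) ≈ one
geometric f zero    = solve 1 (λ f → f :* con (+ 1) :+ (con (+ 1) :- f) :* con (+ 1) := con (+ 1)) ≈-refl f
geometric f (suc K) = begin
  (f ⊛ (∑≤ (pow (one ⊖ f)) K ⊕ p)) ⊕ ((one ⊖ f) ⊛ p)
    ≈⟨ solve 3 (λ f s p → f :* (s :+ p) :+ (con (+ 1) :- f) :* p := f :* s :+ p) ≈-refl f (∑≤ (pow (one ⊖ f)) K) p ⟩
  (f ⊛ ∑≤ (pow (one ⊖ f)) K) ⊕ p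
    ≈⟨ geometric f K ⟩
  one ∎
  where p = pow (one ⊖ f) (suc K)

-- The limit of `geometric`: 1 - f has zero constant term, so the remainder (1 - f)^(K+1) tends to
-- 0.
⊛-inv : ∀ f → f 0 ≡ + 1 → f ⊛ inv f ≈ one
⊛-inv f f0 = ≈-trans (mk≈ λ n → sym (ℤP.+-identityʳ ((f ⊛ inv f) n)))
  (⟶-unique {λ K → (f ⊛ ∑≤ (pow (one ⊖ f)) K) ⊕ pow (one ⊖ f) (suc K)}
    (⟶-⊕ (⟶-⊛ (⟶-const {f}) sums⟶inv) powers⟶0) ⟶-const (geometric f))
  where
  v = vanishes<-pow (cong (λ z → + 1 ℤ.- z) f0)
  sums⟶inv : ∑≤ (pow (one ⊖ f)) ⟶ inv f
  sums⟶inv = ∑≤⟶∑∞ (pow (one ⊖ f)) v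
  powers⟶0 : (λ K → pow (one ⊖ f) (suc K)) ⟶ zeroS
  powers⟶0 .stable K n n≤K = v (suc K) n (s≤s n≤K)

⊛-cancelˡ : ∀ f {x y} → f 0 ≡ + 1 → f ⊛ x ≈ f ⊛ y → x ≈ y
⊛-cancelˡ f {x} {y} f0 e = begin
  x                   ≈⟨ expand x ⟩
  inv f ⊛ (f ⊛ x)     ≈⟨ ⊛-congˡ (inv f) e ⟩
  inv f ⊛ (f ⊛ y)     ≈⟨ expand y ⟨
  y                   ∎
  where
  expand : ∀ z → z ≈ inv f ⊛ (f ⊛ z)
  expand z = begin
    z                 ≈⟨ ⊛-identityˡ z ⟨
    one ⊛ z           ≈⟨ ⊛-congʳ z (⊛-inv f f0) ⟨
    (f ⊛ inv f) ⊛ z   ≈⟨ solve 3 (λ f i z → f :* i :* z := i :* (f :* z)) ≈-refl f (inv f) z ⟩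
    inv f ⊛ (f ⊛ z)   ∎

-- Pochhammer products

q^ : ℕ → Series
q^ k = mono (+ 1) k

q^-+ : ∀ a b → q^ (a + b) ≈ q^ a ⊛ q^ b
q^-+ a b .at n with n <? a
... | yes n<a = trans (vanishes<-mono (+ 1) (m≤m+n a b) n n<a)
                      (sym (vanishes<-⊛ˡ a (q^ b) (vanishes<-mono (+ 1) ≤-refl) n n<a))
... | no n≮a  = subst (λ n → q^ (a + b) n ≡ (q^ a ⊛ q^ b) n) (m+[n∸m]≡n (≮⇒≥ n≮a))
  (trans (drop a) (sym (trans (mono-⊛ (+ 1) a (q^ b) _) (ℤP.*-identityˡ _))))
  where
  drop : ∀ a {m} → q^ (a + b) (a + m) ≡ q^ b m
  drop zero        = refl
  drop (suc a) {m} = trans (mono-suc (+ 1) (a + b) (a + m)) (drop a)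

mono2≈ : ∀ k → mono (+ 2) k ≈ mono (+ 2) 0 ⊛ q^ k
mono2≈ k .at n = sym (trans (mono0-⊛ (+ 2) (q^ k) n) (scale n))
  where
  scale : ∀ n → + 2 ℤ.* q^ k n ≡ mono (+ 2) k n
  scale n with k ≟ n
  ... | yes _ = refl
  ... | no _  = refl

1⊖mono-1 : ∀ k → one ⊖ mono (- + 1) k ≈ one ⊕ q^ k
1⊖mono-1 k .at n with k ≟ n
... | yes _ = refl
... | no _  = refl

prodTo-cong : ∀ n {F G} → (∀ i → F i ≈ G i) → prodTo n F ≈ prodTo n G
prodTo-cong zero    e = ≈-refl
prodTo-cong (suc n) e = ⊛-cong (prodTo-cong n e) (e n)

prodTo-suc : ∀ n F → prodTo (suc n) F ≈ F 0 ⊛ prodTo n (F ∘ suc)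
prodTo-suc zero    F = ⊛-comm one (F 0)
prodTo-suc (suc n) F = begin
  prodTo (suc n) F ⊛ F (suc n)
    ≈⟨ ⊛-congʳ (F (suc n)) (prodTo-suc n F) ⟩
  (F 0 ⊛ prodTo n (F ∘ suc)) ⊛ F (suc n)
    ≈⟨ solve 3 (λ f p g → f :* p :* g := f :* (p :* g)) ≈-refl (F 0) (prodTo n (F ∘ suc)) (F (suc n)) ⟩
  F 0 ⊛ prodTo (suc n) (F ∘ suc) ∎

prodTo-at0 : ∀ n {F} → (∀ i → F i 0 ≡ + 1) → prodTo n F 0 ≡ + 1
prodTo-at0 zero    F0 = refl
prodTo-at0 (suc n) F0 = cong₂ ℤ._*_ (prodTo-at0 n F0) (F0 n)

poch-at0 : ∀ ε s t n → poch ε (suc s) t n 0 ≡ + 1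
poch-at0 ε s t n = prodTo-at0 n (λ i → refl)

1⊖mono≈1 : ∀ a {k n} → n < k → (one ⊖ mono a k) n ≡ one n
1⊖mono≈1 a {n = n} n<k = trans (cong (λ z → one n ℤ.- z) (vanishes<-mono a ≤-refl n n<k)) (ℤP.+-identityʳ (one n))

poch⟶pochInf : ∀ ε s t → poch ε (suc s) (suc t) ⟶ pochInf ε (suc s) (suc t)
poch⟶pochInf ε s t .stable K n n≤K =
  -- Stabilisation ends at n factors, whereas `pochInf` takes n + 1 of them; one more application of
  -- `step` bridges the gap.
  trans (stabilise {poch ε (suc s) (suc t)} step K n n≤K) (sym (step n n ≤-refl))
  where
  step : ∀ K n → n ≤ K → poch ε (suc s) (suc t) (suc K) n ≡ poch ε (suc s) (suc t) K n
  step K n n≤K = trans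
    (⊛-cong-at n {p} {p} {one ⊖ mono ε (suc s + suc t * K)} {one} (λ _ _ → refl)
      (λ i i≤n → 1⊖mono≈1 ε (s≤s (≤-trans i≤n (≤-trans n≤K
        (≤-trans (m≤m+n K (t * K)) (m≤n+m (K + t * K) s)))))))
    (trans (⊛-comm p one .at n) (⊛-identityˡ p .at n))
    where p = poch ε (suc s) (suc t) K

-- Splits off the first factor, whereas the definition of `prodTo` splits off the last. The equation
-- for `s′` lets the shifted exponent be written in a convenient form.
poch-suc : ∀ ε s t {s′} n → s + t ≡ s′ → poch ε s t (suc n) ≈ (one ⊖ mono ε s) ⊛ poch ε s′ t n
poch-suc ε s t n refl = ≈-trans (prodTo-suc n (λ m → one ⊖ mono ε (s + t * m)))
  (⊛-cong (≡⇒≈ (cong (λ k → one ⊖ mono ε k) (trans (cong (λ k → s + k) (*-zeroʳ t)) (+-identityʳ s))))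
          (prodTo-cong n (λ m → ≡⇒≈ (cong (λ k → one ⊖ mono ε k)
             (trans (cong (λ k → s + k) (*-suc t m)) (sym (+-assoc s t (t * m))))))))

pochInf-suc : ∀ ε s t {s′} → suc (s + suc t) ≡ suc s′ →
  pochInf ε (suc s) (suc t) ≈ (one ⊖ mono ε (suc s)) ⊛ pochInf ε (suc s′) (suc t)
pochInf-suc ε s t {s′} e = ⟶-unique
  (⟶-suc (poch⟶pochInf ε s t))
  (⟶-⊛ (⟶-const {one ⊖ mono ε (suc s)}) (poch⟶pochInf ε s′ t))
  (λ n → poch-suc ε (suc s) (suc t) n e)

-- Solution of the functional equations

infinitePart : ℕ → Series
infinitePart c = pochInf (- + 1) (suc c) 2 ⊛ inv (pochInf (+ 1) (suc c) 1)

-- Passing from c to c + 2 removes the single factor 1 + q^(c+1) from the numerator, whose exponents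
-- advance by 2, but the two factors on the left from the denominator, whose exponents advance by 1.
infinitePart-shift : ∀ c →
  ((one ⊖ q^ (1 + c)) ⊛ (one ⊖ q^ (2 + c))) ⊛ infinitePart c ≈ (one ⊕ q^ (1 + c)) ⊛ infinitePart (2 + c)
infinitePart-shift c = begin
  x ⊛ (A ⊛ iB)                   ≈⟨ ⊛-congˡ x (⊛-congʳ iB A≈) ⟩
  x ⊛ ((y ⊛ A′) ⊛ iB)            ≈⟨ solve 4 (λ x y a i → x :* (y :* a :* i) := y :* a :* x :* i :* con (+ 1)) ≈-refl x y A′ iB ⟩
  -- Insert 1 = `B′ ⊛ iB′`: then `x ⊛ B′` is `B` and cancels `iB`, leaving `iB′`.
  (((y ⊛ A′) ⊛ x) ⊛ iB) ⊛ one    ≈⟨ ⊛-congˡ (((y ⊛ A′) ⊛ x) ⊛ iB) (⊛-inv B′ refl) ⟨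
  (((y ⊛ A′) ⊛ x) ⊛ iB) ⊛ (B′ ⊛ iB′)
    ≈⟨ solve 6 (λ x y a i b j → y :* a :* x :* i :* (b :* j) := x :* b :* i :* (y :* (a :* j))) ≈-refl x y A′ iB B′ iB′ ⟩
  ((x ⊛ B′) ⊛ iB) ⊛ (y ⊛ (A′ ⊛ iB′)) ≈⟨ ⊛-congʳ (y ⊛ (A′ ⊛ iB′)) (≈-trans (⊛-congʳ iB (≈-sym B≈)) (⊛-inv B refl)) ⟩
  one ⊛ (y ⊛ (A′ ⊛ iB′))         ≈⟨ ⊛-identityˡ (y ⊛ (A′ ⊛ iB′)) ⟩
  y ⊛ (A′ ⊛ iB′)                 ∎
  where
  x = (one ⊖ q^ (1 + c)) ⊛ (one ⊖ q^ (2 + c))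
  y = one ⊕ q^ (1 + c)
  A = pochInf (- + 1) (1 + c) 2
  A′ = pochInf (- + 1) (3 + c) 2
  B = pochInf (+ 1) (1 + c) 1
  B′ = pochInf (+ 1) (3 + c) 1
  B″ = pochInf (+ 1) (2 + c) 1
  iB = inv B
  iB′ = inv B′
  A≈ : A ≈ y ⊛ A′
  A≈ = ≈-trans (pochInf-suc (- + 1) c 1 (cong suc (+-comm c 2))) (⊛-congʳ A′ (1⊖mono-1 (1 + c)))
  B≈ : B ≈ x ⊛ B′
  B≈ = begin
    B         ≈⟨ pochInf-suc (+ 1) c 0 (cong suc (+-comm c 1)) ⟩
    (one ⊖ q^ (1 + c)) ⊛ B″ ≈⟨ ⊛-congˡ (one ⊖ q^ (1 + c)) (pochInf-suc (+ 1) (1 + c) 0 (cong suc (+-comm (1 + c) 1))) ⟩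
    (one ⊖ q^ (1 + c)) ⊛ ((one ⊖ q^ (2 + c)) ⊛ B′)
      ≈⟨ solve 3 (λ f g h → f :* (g :* h) := f :* g :* h) ≈-refl (one ⊖ q^ (1 + c)) (one ⊖ q^ (2 + c)) B′ ⟩
    x ⊛ B′ ∎

-- Terms of the two sums and their recurrences.

q^-split : ∀ {k} a b → k ≡ a + b → q^ k ≈ q^ a ⊛ q^ b
q^-split a b refl = q^-+ a b

-- The two lengths are independent because g_n needs n and n, while h_n needs n and n + 1.
den : ℕ → ℕ → ℕ → Series
den c m n = poch (+ 1) 2 2 m ⊛ poch (- + 1) (suc c) 2 n

den-at0 : ∀ c m n → den c m n 0 ≡ + 1
den-at0 c m n = cong₂ ℤ._*_ (poch-at0 (+ 1) 1 2 m) (poch-at0 (- + 1) c 2 n)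

gTerm : ℕ → ℕ → Series
gTerm c zero    = one
gTerm c (suc m) = mono (+ 2) (suc m * (suc m + 1) + c * suc m) ⊛
                  (poch (- + 1) 2 2 m ⊛ inv (den c (suc m) (suc m)))

hTerm : ℕ → ℕ → Series
hTerm c n = q^ (n * (n + 1) + c * n) ⊛ (poch (- + 1) 2 2 n ⊛ inv (den c n (suc n)))

inv-unique : ∀ f {x} → f 0 ≡ + 1 → f ⊛ x ≈ one → x ≈ inv f
inv-unique f f0 e = ⊛-cancelˡ f f0 (≈-trans e (≈-sym (⊛-inv f f0)))

-- All terms with index m + 1 at c or c + 2, or with index m at c + 2, are brought to the common
-- factor `i′` = 1 / `D′`. Each recurrence then becomes a polynomial identity in `v` and `w`.
module TermRecurrence (c m : ℕ) where

  v w e A P Q D′ i′ : Series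
  v = q^ (1 + c)
  w = q^ (2 + 2 * m)
  e = q^ (suc m * (suc m + 1) + c * suc m)
  A = poch (- + 1) 2 2 m
  P = poch (+ 1) 2 2 m
  Q = poch (- + 1) (3 + c) 2 (suc m)
  D′ = den (2 + c) (suc m) (suc m)
  i′ = inv D′

  D′i′ : D′ ⊛ i′ ≈ one
  D′i′ = ⊛-inv D′ (den-at0 (2 + c) (suc m) (suc m))

  Q-suc : poch (- + 1) (suc c) 2 (2 + m) ≈ (one ⊕ v) ⊛ Q
  Q-suc = ≈-trans (poch-suc (- + 1) (suc c) 2 (suc m) (cong suc (+-comm c 2))) (⊛-congʳ Q (1⊖mono-1 (1 + c)))

  last-factor : one ⊖ mono (- + 1) (suc c + 2 * suc m) ≈ one ⊕ (v ⊛ w)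
  last-factor = ≈-trans (1⊖mono-1 _) (⊕-cong (≈-refl {one})
    (≈-trans (≡⇒≈ (cong (λ k → q^ (suc c + k)) (*-suc 2 m))) (q^-+ (1 + c) (2 + 2 * m))))

  inv-h : (one ⊕ v) ⊛ inv (den c (suc m) (2 + m)) ≈ i′
  inv-h = inv-unique D′ (den-at0 (2 + c) (suc m) (suc m)) (begin
    D′ ⊛ ((one ⊕ v) ⊛ i)
      ≈⟨ solve 4 (λ p q y i → p :* q :* (y :* i) := p :* (y :* q) :* i) ≈-refl P₁ Q (one ⊕ v) i ⟩
    (P₁ ⊛ ((one ⊕ v) ⊛ Q)) ⊛ i  ≈⟨ ⊛-congʳ i (⊛-congˡ P₁ Q-suc) ⟨
    den c (suc m) (2 + m) ⊛ i ≈⟨ ⊛-inv (den c (suc m) (2 + m)) (den-at0 c (suc m) (2 + m)) ⟩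
    one ∎)
    where
    P₁ = poch (+ 1) 2 2 (suc m)
    i = inv (den c (suc m) (2 + m))

  inv-h′ : inv (den (2 + c) m (suc m)) ≈ (one ⊖ w) ⊛ i′
  inv-h′ = ≈-sym (inv-unique (den (2 + c) m (suc m)) (den-at0 (2 + c) m (suc m)) (begin
    (P ⊛ Q) ⊛ ((one ⊖ w) ⊛ i′)
      ≈⟨ solve 4 (λ p q y i → p :* q :* (y :* i) := p :* y :* q :* i) ≈-refl P Q (one ⊖ w) i′ ⟩
    D′ ⊛ i′ ≈⟨ D′i′ ⟩
    one ∎))

  -- The product (-q^(c+1);q²)_{m+2} is split in two ways: its first factor is 1 + v, its last is 1
  -- + vw.
  inv-g : (one ⊕ v) ⊛ inv (den c (suc m) (suc m)) ≈ (one ⊕ (v ⊛ w)) ⊛ i′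
  inv-g = ⊛-cancelˡ D′ (den-at0 (2 + c) (suc m) (suc m)) (begin
    D′ ⊛ ((one ⊕ v) ⊛ i)
      ≈⟨ solve 4 (λ p q y i → p :* q :* (y :* i) := p :* (y :* q) :* i) ≈-refl P₁ Q (one ⊕ v) i ⟩
    (P₁ ⊛ ((one ⊕ v) ⊛ Q)) ⊛ i  ≈⟨ ⊛-congʳ i (⊛-congˡ P₁ (≈-trans (≈-sym Q-suc) (⊛-congˡ Q₁ last-factor))) ⟩
    (P₁ ⊛ (Q₁ ⊛ (one ⊕ (v ⊛ w)))) ⊛ i
      ≈⟨ solve 4 (λ p q y i → p :* (q :* y) :* i := p :* q :* i :* y) ≈-refl P₁ Q₁ (one ⊕ (v ⊛ w)) i ⟩
    (den c (suc m) (suc m) ⊛ i) ⊛ (one ⊕ (v ⊛ w))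
      ≈⟨ ⊛-congʳ (one ⊕ (v ⊛ w)) (≈-trans (⊛-inv (den c (suc m) (suc m)) (den-at0 c (suc m) (suc m))) (≈-sym D′i′)) ⟩
    (D′ ⊛ i′) ⊛ (one ⊕ (v ⊛ w))
      ≈⟨ solve 3 (λ d i y → d :* i :* y := d :* (y :* i)) ≈-refl D′ i′ (one ⊕ (v ⊛ w)) ⟩
    D′ ⊛ ((one ⊕ (v ⊛ w)) ⊛ i′) ∎)
    where
    P₁ = poch (+ 1) 2 2 (suc m)
    Q₁ = poch (- + 1) (suc c) 2 (suc m)
    i = inv (den c (suc m) (suc m))

  e′≈ : q^ (suc m * (suc m + 1) + (2 + c) * suc m) ≈ e ⊛ w
  e′≈ = q^-split (suc m * (suc m + 1) + c * suc m) (2 + 2 * m) (exponent-c c m)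

  e″≈ : q^ (2 + c) ⊛ q^ (m * (m + 1) + (2 + c) * m) ≈ e
  e″≈ = ≈-sym (q^-split (2 + c) (m * (m + 1) + (2 + c) * m) (exponent-m c m))

  -- The factor q^(c+2) makes up exactly for the lower index in the exponent, and the missing last
  -- factor of (q²;q²)_{m+1} appears as 1 - w.
  uh′ : q^ (2 + c) ⊛ hTerm (2 + c) m ≈ e ⊛ (A ⊛ ((one ⊖ w) ⊛ i′))
  uh′ = begin
    u ⊛ (q^ k ⊛ (A ⊛ j))  ≈⟨ solve 4 (λ u k a j → u :* (k :* (a :* j)) := u :* k :* (a :* j)) ≈-refl u (q^ k) A j ⟩
    (u ⊛ q^ k) ⊛ (A ⊛ j)  ≈⟨ ⊛-cong e″≈ (⊛-congˡ A inv-h′) ⟩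
    e ⊛ (A ⊛ ((one ⊖ w) ⊛ i′)) ∎
    where
    u = q^ (2 + c)
    k = m * (m + 1) + (2 + c) * m
    j = inv (den (2 + c) m (suc m))

  g′≈ : gTerm (2 + c) (suc m) ≈ (mono (+ 2) 0 ⊛ (e ⊛ w)) ⊛ (A ⊛ i′)
  g′≈ = ⊛-congʳ (A ⊛ i′) (≈-trans (mono2≈ _) (⊛-congˡ (mono (+ 2) 0) e′≈))

  -- Over the common denominator this is 1 + w = 2w + (1 - w).
  h-rec : (one ⊕ v) ⊛ hTerm c (suc m) ≈ gTerm (2 + c) (suc m) ⊕ (q^ (2 + c) ⊛ hTerm (2 + c) m)
  h-rec = begin
    (one ⊕ v) ⊛ (e ⊛ ((A ⊛ (one ⊖ mono (- + 1) (2 + 2 * m))) ⊛ i))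
      ≈⟨ solve 5 (λ y e a z i → y :* (e :* (a :* z :* i)) := e :* (a :* z :* (y :* i))) ≈-refl
         (one ⊕ v) e A (one ⊖ mono (- + 1) (2 + 2 * m)) i ⟩
    e ⊛ ((A ⊛ (one ⊖ mono (- + 1) (2 + 2 * m))) ⊛ ((one ⊕ v) ⊛ i))
      ≈⟨ ⊛-congˡ e (⊛-cong (⊛-congˡ A (1⊖mono-1 (2 + 2 * m))) inv-h) ⟩
    e ⊛ ((A ⊛ (one ⊕ w)) ⊛ i′)
      ≈⟨ solve 4 (λ e a w i → e :* (a :* (con (+ 1) :+ w) :* i)
           := con (+ 2) :* (e :* w) :* (a :* i) :+ e :* (a :* ((con (+ 1) :- w) :* i))) ≈-refl e A w i′ ⟩
    ((mono (+ 2) 0 ⊛ (e ⊛ w)) ⊛ (A ⊛ i′)) ⊕ (e ⊛ (A ⊛ ((one ⊖ w) ⊛ i′)))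
      ≈⟨ ⊕-cong g′≈ uh′ ⟨
    gTerm (2 + c) (suc m) ⊕ (q^ (2 + c) ⊛ hTerm (2 + c) m) ∎
    where i = inv (den c (suc m) (2 + m))

  -- Over the common denominator this is 2(1 + vw) = 2(1 + v)w + 2(1 - w).
  g-rec : (one ⊕ v) ⊛ gTerm c (suc m) ≈
          ((one ⊕ v) ⊛ gTerm (2 + c) (suc m)) ⊕ (mono (+ 2) 0 ⊛ (q^ (2 + c) ⊛ hTerm (2 + c) m))
  g-rec = begin
    (one ⊕ v) ⊛ (mono (+ 2) (suc m * (suc m + 1) + c * suc m) ⊛ (A ⊛ i))
      ≈⟨ ⊛-congˡ (one ⊕ v) (⊛-congʳ (A ⊛ i) (mono2≈ _)) ⟩
    (one ⊕ v) ⊛ ((mono (+ 2) 0 ⊛ e) ⊛ (A ⊛ i))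
      ≈⟨ solve 4 (λ y e a i → y :* (con (+ 2) :* e :* (a :* i)) := con (+ 2) :* e :* a :* (y :* i)) ≈-refl
         (one ⊕ v) e A i ⟩
    ((mono (+ 2) 0 ⊛ e) ⊛ A) ⊛ ((one ⊕ v) ⊛ i)
      ≈⟨ ⊛-congˡ ((mono (+ 2) 0 ⊛ e) ⊛ A) inv-g ⟩
    ((mono (+ 2) 0 ⊛ e) ⊛ A) ⊛ ((one ⊕ (v ⊛ w)) ⊛ i′)
      ≈⟨ solve 5 (λ e a v w i → con (+ 2) :* e :* a :* ((con (+ 1) :+ v :* w) :* i)
           := (con (+ 1) :+ v) :* (con (+ 2) :* (e :* w) :* (a :* i))
              :+ con (+ 2) :* (e :* (a :* ((con (+ 1) :- w) :* i)))) ≈-refl e A v w i′ ⟩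
    ((one ⊕ v) ⊛ ((mono (+ 2) 0 ⊛ (e ⊛ w)) ⊛ (A ⊛ i′))) ⊕ (mono (+ 2) 0 ⊛ (e ⊛ (A ⊛ ((one ⊖ w) ⊛ i′))))
      ≈⟨ ⊕-cong (⊛-congˡ (one ⊕ v) g′≈) (⊛-congˡ (mono (+ 2) 0) uh′) ⟨
    ((one ⊕ v) ⊛ gTerm (2 + c) (suc m)) ⊕ (mono (+ 2) 0 ⊛ (q^ (2 + c) ⊛ hTerm (2 + c) m)) ∎
    where i = inv (den c (suc m) (suc m))

-- The index 0 has no preceding term of h; the value 1 is g_0 at c + 2.
h-rec₀ : ∀ c → (one ⊕ q^ (1 + c)) ⊛ hTerm c 0 ≈ one
h-rec₀ c = begin
  (one ⊕ v) ⊛ (q^ (c * 0) ⊛ (one ⊛ i))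
    ≈⟨ ⊛-congˡ (one ⊕ v) (≈-trans (⊛-congʳ (one ⊛ i) (≡⇒≈ (cong q^ (*-zeroʳ c))))
       (solve 1 (λ i → con (+ 1) :* (con (+ 1) :* i) := i) ≈-refl i)) ⟩
  (one ⊕ v) ⊛ i   ≈⟨ ⊛-congʳ i den≈ ⟨
  den c 0 1 ⊛ i   ≈⟨ ⊛-inv (den c 0 1) refl ⟩
  one ∎
  where
  v = q^ (1 + c)
  i = inv (den c 0 1)
  den≈ : den c 0 1 ≈ one ⊕ v
  den≈ = begin
    one ⊛ (one ⊛ (one ⊖ mono (- + 1) (suc c + 0)))
      ≈⟨ solve 1 (λ x → con (+ 1) :* (con (+ 1) :* x) := x) ≈-refl (one ⊖ mono (- + 1) (suc c + 0)) ⟩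
    one ⊖ mono (- + 1) (suc c + 0) ≈⟨ 1⊖mono-1 (suc c + 0) ⟩
    one ⊕ q^ (suc c + 0)  ≈⟨ ≡⇒≈ (cong (λ k → one ⊕ q^ k) (+-identityʳ (suc c))) ⟩
    one ⊕ v ∎

-- `h-rec` is summed over the positive indices, with `h-rec₀` at index 0. The shift of index makes
-- the last sum stop at K rather than K + 1.
∑h-rec : ∀ c K → (one ⊕ q^ (1 + c)) ⊛ ∑≤ (hTerm c) (suc K) ≈
                 ∑≤ (gTerm (2 + c)) (suc K) ⊕ (q^ (2 + c) ⊛ ∑≤ (hTerm (2 + c)) K)
∑h-rec c = step
  where
  y = one ⊕ q^ (1 + c)
  u = q^ (2 + c)
  h = hTerm c
  g′ = gTerm (2 + c)
  h′ = hTerm (2 + c)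
  step : ∀ K → y ⊛ ∑≤ h (suc K) ≈ ∑≤ g′ (suc K) ⊕ (u ⊛ ∑≤ h′ K)
  step zero = begin
    y ⊛ (h 0 ⊕ h 1) ≈⟨ solve 3 (λ y a b → y :* (a :+ b) := y :* a :+ y :* b) ≈-refl y (h 0) (h 1) ⟩
    (y ⊛ h 0) ⊕ (y ⊛ h 1) ≈⟨ ⊕-cong (h-rec₀ c) (TermRecurrence.h-rec c 0) ⟩
    one ⊕ (g′ 1 ⊕ (u ⊛ h′ 0)) ≈⟨ solve 3 (λ a b c → a :+ (b :+ c) := a :+ b :+ c) ≈-refl one (g′ 1) (u ⊛ h′ 0) ⟩
    (one ⊕ g′ 1) ⊕ (u ⊛ h′ 0) ∎
  step (suc K) = begin
    y ⊛ (∑≤ h (suc K) ⊕ h (2 + K))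
      ≈⟨ solve 3 (λ y a b → y :* (a :+ b) := y :* a :+ y :* b) ≈-refl y (∑≤ h (suc K)) (h (2 + K)) ⟩
    (y ⊛ ∑≤ h (suc K)) ⊕ (y ⊛ h (2 + K)) ≈⟨ ⊕-cong (step K) (TermRecurrence.h-rec c (suc K)) ⟩
    (∑≤ g′ (suc K) ⊕ (u ⊛ ∑≤ h′ K)) ⊕ (g′ (2 + K) ⊕ (u ⊛ h′ (suc K)))
      ≈⟨ solve 5 (λ a u b c d → a :+ u :* b :+ (c :+ u :* d) := a :+ c :+ u :* (b :+ d)) ≈-refl
         (∑≤ g′ (suc K)) u (∑≤ h′ K) (g′ (2 + K)) (h′ (suc K)) ⟩
    (∑≤ g′ (2 + K)) ⊕ (u ⊛ ∑≤ h′ (suc K)) ∎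

∑g-rec : ∀ c K → (one ⊕ q^ (1 + c)) ⊛ ∑≤ (gTerm c) (suc K) ≈
  ((one ⊕ q^ (1 + c)) ⊛ ∑≤ (gTerm (2 + c)) (suc K)) ⊕ (mono (+ 2) 0 ⊛ (q^ (2 + c) ⊛ ∑≤ (hTerm (2 + c)) K))
∑g-rec c = step
  where
  y = one ⊕ q^ (1 + c)
  u = q^ (2 + c)
  g = gTerm c
  g′ = gTerm (2 + c)
  h′ = hTerm (2 + c)
  step : ∀ K → y ⊛ ∑≤ g (suc K) ≈ (y ⊛ ∑≤ g′ (suc K)) ⊕ (mono (+ 2) 0 ⊛ (u ⊛ ∑≤ h′ K))
  step zero = begin
    y ⊛ (one ⊕ g 1) ≈⟨ solve 3 (λ y a b → y :* (a :+ b) := y :* a :+ y :* b) ≈-refl y one (g 1) ⟩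
    (y ⊛ one) ⊕ (y ⊛ g 1) ≈⟨ ⊕-cong (≈-refl {y ⊛ one}) (TermRecurrence.g-rec c 0) ⟩
    (y ⊛ one) ⊕ ((y ⊛ g′ 1) ⊕ (mono (+ 2) 0 ⊛ (u ⊛ h′ 0)))
      ≈⟨ solve 4 (λ y a b c → y :* a :+ (y :* b :+ c) := y :* (a :+ b) :+ c) ≈-refl y one (g′ 1) (mono (+ 2) 0 ⊛ (u ⊛ h′ 0)) ⟩
    (y ⊛ (one ⊕ g′ 1)) ⊕ (mono (+ 2) 0 ⊛ (u ⊛ h′ 0)) ∎
  step (suc K) = begin
    y ⊛ (∑≤ g (suc K) ⊕ g (2 + K))
      ≈⟨ solve 3 (λ y a b → y :* (a :+ b) := y :* a :+ y :* b) ≈-refl y (∑≤ g (suc K)) (g (2 + K)) ⟩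
    (y ⊛ ∑≤ g (suc K)) ⊕ (y ⊛ g (2 + K)) ≈⟨ ⊕-cong (step K) (TermRecurrence.g-rec c (suc K)) ⟩
    ((y ⊛ ∑≤ g′ (suc K)) ⊕ (mono (+ 2) 0 ⊛ (u ⊛ ∑≤ h′ K))) ⊕ ((y ⊛ g′ (2 + K)) ⊕ (mono (+ 2) 0 ⊛ (u ⊛ h′ (suc K))))
      ≈⟨ solve 6 (λ y a u b c d → y :* a :+ con (+ 2) :* (u :* b) :+ (y :* c :+ con (+ 2) :* (u :* d))
                    := y :* (a :+ c) :+ con (+ 2) :* (u :* (b :+ d))) ≈-refl
         y (∑≤ g′ (suc K)) u (∑≤ h′ K) (g′ (2 + K)) (h′ (suc K)) ⟩
    (y ⊛ ∑≤ g′ (2 + K)) ⊕ (mono (+ 2) 0 ⊛ (u ⊛ ∑≤ h′ (suc K))) ∎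

-- The bound n + cn serves twice: it is at least n, for convergence, and at least c + 1 when n ≥ 1,
-- for the base of the induction.
gTerm-vanishes : ∀ c n → Vanishes< (n + c * n) (gTerm c n)
gTerm-vanishes c zero    i i<0 = mono-miss (+ 1) (λ { refl → <⇒≱ i<0 (≤-trans (≤-reflexive (*-zeroʳ c)) z≤n) })
gTerm-vanishes c (suc m) = vanishes<-⊛ˡ (suc m + c * suc m) (poch (- + 1) 2 2 m ⊛ inv (den c (suc m) (suc m)))
  (vanishes<-mono (+ 2) (+-monoˡ-≤ (c * suc m) (m≤m*n (suc m) (suc m + 1))))

hTerm-vanishes : ∀ c n → Vanishes< (n + c * n) (hTerm c n)
hTerm-vanishes c n = vanishes<-⊛ˡ (n + c * n) (poch (- + 1) 2 2 n ⊛ inv (den c n (suc n)))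
  (vanishes<-mono (+ 1) (+-monoˡ-≤ (c * n) (exponent n)))
  where
  exponent : ∀ n → n ≤ n * (n + 1)
  exponent zero    = z≤n
  exponent (suc n) = m≤m*n (suc n) (suc n + 1)

gSum hSum : ℕ → Series
gSum c = ∑∞ (gTerm c)
hSum c = ∑∞ (hTerm c)

∑g⟶gSum : ∀ c → ∑≤ (gTerm c) ⟶ gSum c
∑g⟶gSum c = ∑≤⟶∑∞ (gTerm c) (λ n i i<n → gTerm-vanishes c n i (≤-trans i<n (m≤m+n n (c * n))))

∑h⟶hSum : ∀ c → ∑≤ (hTerm c) ⟶ hSum c
∑h⟶hSum c = ∑≤⟶∑∞ (hTerm c) (λ n i i<n → hTerm-vanishes c n i (≤-trans i<n (m≤m+n n (c * n))))

hSum-rec : ∀ c → (one ⊕ q^ (1 + c)) ⊛ hSum c ≈ gSum (2 + c) ⊕ (q^ (2 + c) ⊛ hSum (2 + c))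
hSum-rec c = ⟶-unique
  (⟶-⊛ (⟶-const {one ⊕ q^ (1 + c)}) (⟶-suc (∑h⟶hSum c)))
  (⟶-⊕ (⟶-suc (∑g⟶gSum (2 + c))) (⟶-⊛ (⟶-const {q^ (2 + c)}) (∑h⟶hSum (2 + c))))
  (∑h-rec c)

gSum-rec : ∀ c → (one ⊕ q^ (1 + c)) ⊛ gSum c ≈
  ((one ⊕ q^ (1 + c)) ⊛ gSum (2 + c)) ⊕ (mono (+ 2) 0 ⊛ (q^ (2 + c) ⊛ hSum (2 + c)))
gSum-rec c = ⟶-unique
  (⟶-⊛ (⟶-const {one ⊕ q^ (1 + c)}) (⟶-suc (∑g⟶gSum c)))
  (⟶-⊕ (⟶-⊛ (⟶-const {one ⊕ q^ (1 + c)}) (⟶-suc (∑g⟶gSum (2 + c))))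
        (⟶-⊛ (⟶-const {mono (+ 2) 0}) (⟶-⊛ (⟶-const {q^ (2 + c)}) (∑h⟶hSum (2 + c)))))
  (∑g-rec c)

-- The closed-form series and their functional equations.

F₂₂ F₄₀ rayF₂₂ rayF₄₀ : ℕ → Series
F₂₂ c = gSum c ⊛ infinitePart c
F₄₀ c = hSum c ⊛ infinitePart c
rayF₂₂ c = inv (one ⊖ q^ c) ⊛ F₂₂ c
rayF₄₀ c = inv (one ⊖ q^ c) ⊛ F₄₀ c

-- Division by 1 - q^(k+1) in the recursive form that `card-ray` asks of the series `g`.
inv-1⊖q : ∀ k x → inv (one ⊖ q^ (suc k)) ⊛ x ≈ x ⊕ (q^ (suc k) ⊛ (inv (one ⊖ q^ (suc k)) ⊛ x))
inv-1⊖q k x = begin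
  i ⊛ x ≈⟨ solve 3 (λ q i x → i :* x := (con (+ 1) :- q) :* i :* x :+ q :* (i :* x)) ≈-refl q i x ⟩
  (((one ⊖ q) ⊛ i) ⊛ x) ⊕ (q ⊛ (i ⊛ x))
    ≈⟨ ⊕-cong (≈-trans (⊛-congʳ x (⊛-inv (one ⊖ q) refl)) (⊛-identityˡ x)) (≈-refl {q ⊛ (i ⊛ x)}) ⟩
  x ⊕ (q ⊛ (i ⊛ x)) ∎
  where
  q = q^ (suc k)
  i = inv (one ⊖ q)

module _ (c : ℕ) where
  private
    v u y z g g′ h h′ C C′ i : Series
    v = q^ (1 + c)
    u = q^ (2 + c)
    y = one ⊕ v
    z = (one ⊖ v) ⊛ (one ⊖ u)
    g = gSum c
    g′ = gSum (2 + c)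
    h = hSum c
    h′ = hSum (2 + c)
    C = infinitePart c
    C′ = infinitePart (2 + c)
    i = inv (one ⊖ u)

  F₄₀-shift : z ⊛ F₄₀ c ≈ F₂₂ (2 + c) ⊕ (u ⊛ F₄₀ (2 + c))
  F₄₀-shift = begin
    z ⊛ (h ⊛ C)      ≈⟨ solve 3 (λ z h c → z :* (h :* c) := h :* (z :* c)) ≈-refl z h C ⟩
    h ⊛ (z ⊛ C)      ≈⟨ ⊛-congˡ h (infinitePart-shift c) ⟩
    h ⊛ (y ⊛ C′)     ≈⟨ solve 3 (λ h y c → h :* (y :* c) := y :* h :* c) ≈-refl h y C′ ⟩
    (y ⊛ h) ⊛ C′     ≈⟨ ⊛-congʳ C′ (hSum-rec c) ⟩
    (g′ ⊕ (u ⊛ h′)) ⊛ C′ ≈⟨ solve 4 (λ g u h c → (g :+ u :* h) :* c := g :* c :+ u :* (h :* c)) ≈-refl g′ u h′ C′ ⟩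
    (g′ ⊛ C′) ⊕ (u ⊛ (h′ ⊛ C′)) ∎

  F₂₂-shift : z ⊛ F₂₂ c ≈ (y ⊛ F₂₂ (2 + c)) ⊕ (mono (+ 2) 0 ⊛ (u ⊛ F₄₀ (2 + c)))
  F₂₂-shift = begin
    z ⊛ (g ⊛ C)      ≈⟨ solve 3 (λ z h c → z :* (h :* c) := h :* (z :* c)) ≈-refl z g C ⟩
    g ⊛ (z ⊛ C)      ≈⟨ ⊛-congˡ g (infinitePart-shift c) ⟩
    g ⊛ (y ⊛ C′)     ≈⟨ solve 3 (λ h y c → h :* (y :* c) := y :* h :* c) ≈-refl g y C′ ⟩
    (y ⊛ g) ⊛ C′     ≈⟨ ⊛-congʳ C′ (gSum-rec c) ⟩
    ((y ⊛ g′) ⊕ (mono (+ 2) 0 ⊛ (u ⊛ h′))) ⊛ C′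
      ≈⟨ solve 5 (λ y g u h c → (y :* g :+ con (+ 2) :* (u :* h)) :* c := y :* (g :* c) :+ con (+ 2) :* (u :* (h :* c)))
         ≈-refl y g′ u h′ C′ ⟩
    (y ⊛ (g′ ⊛ C′)) ⊕ (mono (+ 2) 0 ⊛ (u ⊛ (h′ ⊛ C′))) ∎

  -- `F₄₀-shift` divided by 1 - u, arranged for counting `Ray₃₁`: the first bracket counts the pairs
  -- whose recorded number equals the largest remaining part, the last summand those where it
  -- exceeds it.
  F₄₀-rec : F₄₀ c ≈ (rayF₂₂ (2 + c) ⊕ (u ⊛ rayF₄₀ (2 + c))) ⊕ (v ⊛ F₄₀ c)
  F₄₀-rec = ⊛-cancelˡ (one ⊖ u) refl (begin
    (one ⊖ u) ⊛ F₄₀ c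
      ≈⟨ solve 3 (λ u v f → (con (+ 1) :- u) :* f
           := (con (+ 1) :- v) :* (con (+ 1) :- u) :* f :+ (con (+ 1) :- u) :* (v :* f)) ≈-refl u v (F₄₀ c) ⟩
    (z ⊛ F₄₀ c) ⊕ w ≈⟨ ⊕-cong F₄₀-shift (≈-refl {w}) ⟩
    (F₂₂ (2 + c) ⊕ (u ⊛ F₄₀ (2 + c))) ⊕ w
      ≈⟨ ⊕-cong (≈-sym (⊛-identityˡ (F₂₂ (2 + c) ⊕ (u ⊛ F₄₀ (2 + c))))) (≈-refl {w}) ⟩
    (one ⊛ (F₂₂ (2 + c) ⊕ (u ⊛ F₄₀ (2 + c)))) ⊕ w
      ≈⟨ ⊕-cong (⊛-congʳ (F₂₂ (2 + c) ⊕ (u ⊛ F₄₀ (2 + c))) (⊛-inv (one ⊖ u) refl)) (≈-refl {w}) ⟨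
    (((one ⊖ u) ⊛ i) ⊛ (F₂₂ (2 + c) ⊕ (u ⊛ F₄₀ (2 + c)))) ⊕ w
      ≈⟨ solve 6 (λ u i f h v k → (con (+ 1) :- u) :* i :* (f :+ u :* h) :+ (con (+ 1) :- u) :* (v :* k)
           := (con (+ 1) :- u) :* (i :* f :+ u :* (i :* h) :+ v :* k)) ≈-refl u i (F₂₂ (2 + c)) (F₄₀ (2 + c)) v (F₄₀ c) ⟩
    (one ⊖ u) ⊛ ((rayF₂₂ (2 + c) ⊕ (u ⊛ rayF₄₀ (2 + c))) ⊕ (v ⊛ F₄₀ c)) ∎)
    where w = (one ⊖ u) ⊛ (v ⊛ F₄₀ c)

  -- The outer summands correspond to whether the first partition contains a largest part or only
  -- the second does; the latter case is again split by whether removing that part lowers the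
  -- maximum.
  F₂₂-rec : F₂₂ c ≈ F₄₀ c ⊕ ((u ⊛ rayF₄₀ (2 + c)) ⊕ (v ⊛ F₄₀ c))
  F₂₂-rec = ⊛-cancelˡ z refl (begin
    z ⊛ F₂₂ c ≈⟨ F₂₂-shift ⟩
    (y ⊛ F₂₂ (2 + c)) ⊕ (mono (+ 2) 0 ⊛ (u ⊛ F₄₀ (2 + c)))
      -- Writing 2 = (1 + v) + (1 - v) isolates a multiple of the right-hand side of `F₄₀-shift`;
      -- the explicit factor 1 is then replaced by (1 - u) times its inverse.
      ≈⟨ solve 4 (λ v u f k → (con (+ 1) :+ v) :* f :+ con (+ 2) :* (u :* k)
           := (con (+ 1) :+ v) :* (f :+ u :* k) :+ u :* (con (+ 1) :- v) :* (con (+ 1) :* k))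
         ≈-refl v u (F₂₂ (2 + c)) (F₄₀ (2 + c)) ⟩
    (y ⊛ (F₂₂ (2 + c) ⊕ (u ⊛ F₄₀ (2 + c)))) ⊕ ((u ⊛ (one ⊖ v)) ⊛ (one ⊛ F₄₀ (2 + c)))
      ≈⟨ ⊕-cong (⊛-congˡ y F₄₀-shift) (⊛-congˡ (u ⊛ (one ⊖ v)) (⊛-congʳ (F₄₀ (2 + c)) (⊛-inv (one ⊖ u) refl))) ⟨
    (y ⊛ (z ⊛ F₄₀ c)) ⊕ ((u ⊛ (one ⊖ v)) ⊛ (((one ⊖ u) ⊛ i) ⊛ F₄₀ (2 + c)))
      ≈⟨ solve 5 (λ v u i f k →
           (con (+ 1) :+ v) :* ((con (+ 1) :- v) :* (con (+ 1) :- u) :* f) :+ u :* (con (+ 1) :- v) :* ((con (+ 1) :- u) :* i :* k)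
           := (con (+ 1) :- v) :* (con (+ 1) :- u) :* (f :+ (u :* (i :* k) :+ v :* f))) ≈-refl v u i (F₄₀ c) (F₄₀ (2 + c)) ⟩
    z ⊛ (F₄₀ c ⊕ ((u ⊛ rayF₄₀ (2 + c)) ⊕ (v ⊛ F₄₀ c))) ∎)

-- Series congruent to 1 modulo q^(c+1)

Unit≤ : ℕ → Series → Set
Unit≤ c f = ∀ n → n ≤ c → f n ≡ one n

unit≤-⊛ : ∀ {c f g} → Unit≤ c f → Unit≤ c g → Unit≤ c (f ⊛ g)
unit≤-⊛ {f = f} {g} uf ug n n≤c = trans
  (⊛-cong-at n {f} {one} {g} {one} (λ i i≤n → uf i (≤-trans i≤n n≤c)) (λ i i≤n → ug i (≤-trans i≤n n≤c)))
  (⊛-identityˡ one .at n)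

-- Up to degree c, 1 may be replaced by f in the product 1 · (1/f), which turns it into f · (1/f) =
-- 1.
unit≤-inv : ∀ {c f} → Unit≤ c f → Unit≤ c (inv f)
unit≤-inv {f = f} uf n n≤c = trans (sym (⊛-identityˡ (inv f) .at n)) (trans
  (⊛-cong-at n {one} {f} {inv f} {inv f} (λ i i≤n → sym (uf i (≤-trans i≤n n≤c))) (λ _ _ → refl))
  (⊛-inv f (uf 0 z≤n) .at n))

unit≤-poch : ∀ {c s} ε t n → c < s → Unit≤ c (poch ε s t n)
unit≤-poch ε t zero    c<s k k≤c = refl
unit≤-poch {s = s} ε t (suc n) c<s = unit≤-⊛ (unit≤-poch ε t n c<s)
  (λ k k≤c → 1⊖mono≈1 ε (≤-trans (s≤s k≤c) (≤-trans c<s (m≤m+n s (t * n)))))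

unit≤-infinitePart : ∀ c → Unit≤ c (infinitePart c)
unit≤-infinitePart c = unit≤-⊛
  (λ n → unit≤-poch (- + 1) 2 (suc n) ≤-refl n)
  (unit≤-inv (λ n → unit≤-poch (+ 1) 1 (suc n) ≤-refl n))

unit≤-∑∞ : ∀ {c} F → Unit≤ c (F 0) → (∀ n → Vanishes< (suc c) (F (suc n))) → Unit≤ c (∑∞ F)
unit≤-∑∞ F u v zero    n≤c = u 0 n≤c
unit≤-∑∞ F u v (suc n) n≤c = trans (sumTo-suc n (λ k → F k (suc n)))
  (cong₂ ℤ._+_ (u (suc n) n≤c) (sumTo-0 n (λ i _ → v i (suc n) (s≤s n≤c))))

suc-exponent : ∀ c n → suc c ≤ suc n + c * suc n
suc-exponent c n = s≤s (≤-trans (m≤m*n c (suc n)) (m≤n+m (c * suc n) n))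

unit≤-F₂₂ : ∀ c → Unit≤ c (F₂₂ c)
unit≤-F₂₂ c = unit≤-⊛
  (unit≤-∑∞ (gTerm c) (λ _ _ → refl) (λ n i i<1+c → gTerm-vanishes c (suc n) i (≤-trans i<1+c (suc-exponent c n))))
  (unit≤-infinitePart c)

unit≤-F₄₀ : ∀ c → Unit≤ c (F₄₀ c)
unit≤-F₄₀ c = unit≤-⊛
  (unit≤-∑∞ (hTerm c) first (λ n i i<1+c → hTerm-vanishes c (suc n) i (≤-trans i<1+c (suc-exponent c n))))
  (unit≤-infinitePart c)
  where
  first : Unit≤ c (hTerm c 0)
  first = unit≤-⊛ (λ n _ → cong (λ k → q^ k n) (*-zeroʳ c))
    (unit≤-⊛ {f = one} (λ _ _ → refl) (unit≤-inv (unit≤-⊛ {f = one} (λ _ _ → refl) (unit≤-poch (- + 1) 2 1 ≤-refl))))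

-- Identification with the right-hand side.

-- Moves the separate leading 1 of `bracket` into index 0 of the sum, where `bracket` has the value
-- 0.
sumTo-head : ∀ N a F G → F 0 ≡ + 0 → G 0 ≡ a → (∀ n → F (suc n) ≡ G (suc n)) → a ℤ.+ sumTo N F ≡ sumTo N G
sumTo-head zero    a F G F0 G0 e = trans (cong (λ z → a ℤ.+ z) F0) (trans (ℤP.+-identityʳ a) (sym G0))
sumTo-head (suc N) a F G F0 G0 e =
  trans (sym (ℤP.+-assoc a _ _)) (cong₂ ℤ._+_ (sumTo-head N a F G F0 G0 e) (e N))

bracket≈gSum : bracket ≈ gSum 0
bracket≈gSum .at N = sumTo-head N (one N) _ (λ n → gTerm 0 n N) refl refl
  (λ n → cong (λ k → (mono (+ 2) k ⊛ (poch (- + 1) 2 2 n ⊛ inv (den 0 (suc n) (suc n)))) N)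
              (sym (+-identityʳ (suc n * (suc n + 1)))))

F₂₂≈rhs : F₂₂ 0 ≈ rhs
F₂₂≈rhs = ⊛-congʳ (infinitePart 0) (≈-sym bracket≈gSum)

-- Counting

-- The count is an integer so that it can be replaced along identities between coefficients of
-- series.
record HasCard {A : Set} (P : A → Set) (z : ℤ) : Set where
  constructor hasCard
  field
    elements : List A
    unique   : Unique elements
    member   : ∀ x → x ∈ elements ⇔ P x
    card     : + length elements ≡ z

private variable
  A B : Set

card-empty : {P : A → Set} → (∀ x → ¬ P x) → HasCard P (+ 0)
card-empty ¬P = hasCard [] [] (λ x → mk⇔ (λ ()) (⊥-elim ∘ ¬P x)) refl

card-singleton : {P : A → Set} → ∀ a → P a → (∀ x → P x → x ≡ a) → HasCard P (+ 1)
card-singleton a Pa only = hasCard (a ∷ []) ([] ∷ [])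
  (λ x → mk⇔ (λ { (here refl) → Pa }) (λ Px → here (only x Px))) refl

card-⊎ : {P Q R : A → Set} {a b : ℤ} → (∀ {x} → R x → P x ⊎ Q x) → (∀ {x} → P x → R x) → (∀ {x} → Q x → R x) →
         (∀ {x} → P x → ¬ Q x) → HasCard P a → HasCard Q b → HasCard R (a ℤ.+ b)
card-⊎ split P⇒R Q⇒R disjoint (hasCard K uK mK refl) (hasCard L uL mL refl) = hasCard (K ++ L)
  (Uniq.++⁺ uK uL (λ (x∈K , x∈L) → disjoint (Equivalence.to (mK _) x∈K) (Equivalence.to (mL _) x∈L)))
  (λ x → mk⇔
    (λ x∈ → [ P⇒R ∘ Equivalence.to (mK x) , Q⇒R ∘ Equivalence.to (mL x) ]′ (∈-++⁻ K x∈))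
    (λ Rx → [ ∈-++⁺ˡ ∘ Equivalence.from (mK x) , ∈-++⁺ʳ K ∘ Equivalence.from (mL x) ]′ (split Rx)))
  (cong +_ (length-++ K))

unique-map : (f : A → B) (g : B → A) (L : List A) → (∀ {x} → x ∈ L → g (f x) ≡ x) → Unique L → Unique (map f L)
unique-map f g []      gf []          = []
unique-map f g (x ∷ L) gf (x∉L ∷ uL) =
  AllP.map⁺ (All.tabulate (λ {y} y∈L fx≡fy → All.lookup x∉L y∈L
    (trans (sym (gf (here refl))) (trans (cong g fx≡fy) (gf (there y∈L))))))
  ∷ unique-map f g L (gf ∘ there) uL

-- The inverse laws are asked only on P and Q, because removing and restoring a first part are
-- inverse only on partitions.
card-map : {P : A → Set} {Q : B → Set} {z : ℤ} (f : A → B) (g : B → A) →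
           (∀ x → P x → Q (f x) × g (f x) ≡ x) → (∀ y → Q y → P (g y) × f (g y) ≡ y) →
           HasCard P z → HasCard Q z
card-map {Q = Q} f g to from (hasCard L uL mL refl) = hasCard (map f L)
  (unique-map f g L (λ x∈L → proj₂ (to _ (Equivalence.to (mL _) x∈L))) uL)
  (λ y → mk⇔
    (λ y∈ → let (x , x∈L , y≡fx) = ∈-map⁻ f y∈ in subst Q (sym y≡fx) (proj₁ (to x (Equivalence.to (mL x) x∈L))))
    (λ Qy → let (Pgy , fgy≡y) = from y Qy in subst (_∈ map f L) fgy≡y (∈-map⁺ f (Equivalence.from (mL (g y)) Pgy))))
  (cong +_ (length-map f L))

card-cong : {P Q : A → Set} {z : ℤ} → (∀ {x} → P x → Q x) → (∀ {x} → Q x → P x) → HasCard P z → HasCard Q z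
card-cong P⇒Q Q⇒P = card-map (λ x → x) (λ x → x) (λ _ Px → P⇒Q Px , refl) (λ _ Qx → Q⇒P Qx , refl)

card-≡ : {P : A → Set} {a b : ℤ} → a ≡ b → HasCard P a → HasCard P b
card-≡ refl h = h

-- If f counts the a in P by the value (1+c)·M a + w a, then f / (1 - q^(1+c)) counts
-- the pairs (m , a) with m ≥ M a by (1+c)·m + w a.
module Ray {A : Set} (P : A → Set) (M w : A → ℕ) (c : ℕ) where

  Edge : ℕ → A → Set
  Edge n a = P a × suc c * M a + w a ≡ n

  Ray Ray⁺ : ℕ → ℕ × A → Set
  Ray  n (m , a) = P a × M a ≤ m × suc c * m + w a ≡ n
  Ray⁺ n (m , a) = P a × M a < m × suc c * m + w a ≡ n

  private
    shift : ∀ m x → suc c * suc m + x ≡ suc c + (suc c * m + x)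
    shift m x = trans (cong (λ k → k + x) (*-suc (suc c) m)) (+-assoc (suc c) (suc c * m) x)

  -- A number m > M a is positive, and lowering it by 1 gives a pair with m ≥ M a and weight smaller
  -- by 1 + c. Only weights below n are consulted, which makes the recursion in `card-ray<`
  -- possible.
  card-ray⁺ : ∀ g n → (∀ k → k < n → HasCard (Ray k) (g k)) → HasCard (Ray⁺ n) ((q^ (suc c) ⊛ g) n)
  card-ray⁺ g n ray with n <? suc c
  ... | yes n<1+c = card-≡ (sym (vanishes<-⊛ˡ (suc c) g (vanishes<-mono (+ 1) ≤-refl) n n<1+c))
    (card-empty λ { (suc m , a) (_ , _ , e) →
      <⇒≱ n<1+c (≤-trans (m≤m+n (suc c) _) (≤-reflexive (trans (sym (shift m (w a))) e))) })
  ... | no n≮1+c = card-≡ coefficient (card-map (λ (m , a) → suc m , a) (λ (m , a) → m ∸ 1 , a)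
    (λ (m , a) (Pa , M≤m , e) → (Pa , s≤s M≤m , trans (shift m (w a)) (trans (cong (λ k → suc c + k) e) n≡)) , refl)
    (λ { (suc m , a) (Pa , s≤s M≤m , e) →
         (Pa , M≤m , +-cancelˡ-≡ (suc c) _ _ (trans (sym (shift m (w a))) (trans e (sym n≡)))) , refl })
    (ray (n ∸ suc c) (∸-monoʳ-< (s≤s z≤n) (≮⇒≥ n≮1+c))))
    where
    n≡ : suc c + (n ∸ suc c) ≡ n
    n≡ = m+[n∸m]≡n (≮⇒≥ n≮1+c)
    coefficient : g (n ∸ suc c) ≡ (q^ (suc c) ⊛ g) n
    coefficient = trans (sym (ℤP.*-identityˡ _)) (trans (sym (mono-⊛ (+ 1) (suc c) g (n ∸ suc c)))
      (cong (q^ (suc c) ⊛ g) n≡))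

  card-edge : ∀ {z} n (S : A → Set) → HasCard (λ a → Edge n a × S a) z →
              HasCard (λ (m , a) → P a × M a ≡ m × suc c * m + w a ≡ n × S a) z
  card-edge n S = card-map (λ a → M a , a) proj₂
    (λ a ((Pa , e) , Sa) → (Pa , refl , e , Sa) , refl)
    (λ { (_ , a) (Pa , refl , e , Sa) → ((Pa , e) , Sa) , refl })

  module _ {f g : Series} (g≈ : g ≈ f ⊕ (q^ (suc c) ⊛ g)) {N : ℕ}
           (edge : ∀ n → n ≤ N → HasCard (Edge n) (f n)) where

    -- Strong induction on n, bounded by b, splitting on M a = m or M a < m. The bound N is there
    -- because the edge counts are available only up to N.
    card-ray< : ∀ b n → n < b → n ≤ N → HasCard (Ray n) (g n)
    card-ray< (suc b) n (s≤s n≤b) n≤N = card-≡ (sym (g≈ .at n)) (card-⊎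
      (λ { (Pa , M≤m , e) → [ (λ M<m → inj₂ (Pa , M<m , e)) , (λ M≡m → inj₁ (Pa , M≡m , e , Pa)) ]′ (m≤n⇒m<n∨m≡n M≤m) })
      (λ (Pa , M≡m , e , _) → Pa , ≤-reflexive M≡m , e)
      (λ (Pa , M<m , e) → Pa , <⇒≤ M<m , e)
      (λ (_ , M≡m , _) (_ , M<m , _) → <⇒≢ M<m M≡m)
      (card-edge n P (card-cong (λ e → e , proj₁ e) proj₁ (edge n n≤N)))
      (card-ray⁺ g n (λ k k<n → card-ray< b k (≤-trans k<n n≤b) (≤-trans (<⇒≤ k<n) n≤N))))

    card-ray : ∀ n → n ≤ N → HasCard (Ray n) (g n)
    card-ray n = card-ray< (suc n) n ≤-refl

-- Partitions by first part and remainder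

hd : List ℕ → ℕ
hd xs = part xs 0

tl : List ℕ → List ℕ
tl []       = []
tl (_ ∷ xs) = xs

-- Prepending the part 0, which is only meaningful for the empty partition, returns it.
cons : ℕ → List ℕ → List ℕ
cons zero    _  = []
cons (suc x) xs = suc x ∷ xs

part-tl : ∀ xs j → part (tl xs) j ≡ part xs (suc j)
part-tl []       j = refl
part-tl (_ ∷ xs) j = refl

tl-partition : ∀ {xs} → IsPartition xs → IsPartition (tl xs)
tl-partition {[]}         _                 = [] , []
tl-partition {x ∷ []}     _                 = [] , []
tl-partition {x ∷ y ∷ xs} (_ ∷ l , _ ∷ pos) = l , pos

hd-tl : ∀ {xs} → IsPartition xs → hd (tl xs) ≤ hd xs
hd-tl {[]}         _           = z≤n
hd-tl {x ∷ []}     _           = z≤n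
hd-tl {x ∷ y ∷ xs} (x≥y ∷ _ , _) = x≥y

part-mono : ∀ {xs} → IsPartition xs → ∀ j → part xs (suc j) ≤ part xs j
part-mono {xs} p zero        = ≤-trans (≤-reflexive (sym (part-tl xs 0))) (hd-tl p)
part-mono {xs} p (suc j) = subst (λ k → k ≤ part xs (suc j)) (part-tl xs (suc j))
  (subst (λ k → part (tl xs) (suc j) ≤ k) (part-tl xs j) (part-mono (tl-partition p) j))

part≤hd : ∀ {xs} → IsPartition xs → ∀ j → part xs j ≤ hd xs
part≤hd p zero    = ≤-refl
part≤hd p (suc j) = ≤-trans (part-mono p j) (part≤hd p j)

sum-hd-tl : ∀ xs → sumList xs ≡ hd xs + sumList (tl xs)
sum-hd-tl []       = refl
sum-hd-tl (x ∷ xs) = refl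

cons-hd-tl : ∀ {xs} → IsPartition xs → cons (hd xs) (tl xs) ≡ xs
cons-hd-tl {[]}         _ = refl
cons-hd-tl {suc x ∷ xs} _ = refl
cons-hd-tl {zero ∷ xs} (_ , () ∷ _)

hd≡0 : ∀ {xs} → IsPartition xs → hd xs ≡ 0 → xs ≡ []
hd≡0 {xs} p e = trans (sym (cons-hd-tl p)) (cong (λ x → cons x (tl xs)) e)

hd-cons : ∀ x xs → hd (cons x xs) ≡ x
hd-cons zero    xs = refl
hd-cons (suc x) xs = refl

tl-cons : ∀ x {xs} → IsPartition xs → hd xs ≤ x → tl (cons x xs) ≡ xs
tl-cons zero    p h = sym (hd≡0 p (n≤0⇒n≡0 h))
tl-cons (suc x) p h = refl

part-cons : ∀ x {xs} → IsPartition xs → hd xs ≤ x → ∀ j → part (cons x xs) (suc j) ≡ part xs j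
part-cons x {xs} p h j = trans (sym (part-tl (cons x xs) j)) (cong (λ ys → part ys j) (tl-cons x p h))

sum-cons : ∀ x {xs} → IsPartition xs → hd xs ≤ x → sumList (cons x xs) ≡ x + sumList xs
sum-cons x {xs} p h = trans (sum-hd-tl (cons x xs)) (cong₂ _+_ (hd-cons x xs) (cong sumList (tl-cons x p h)))

cons-partition : ∀ x {xs} → IsPartition xs → hd xs ≤ x → IsPartition (cons x xs)
cons-partition zero    p         h = [] , []
cons-partition (suc x) {[]}     _         h = [-] , s≤s z≤n ∷ []
cons-partition (suc x) {y ∷ xs} (l , pos) h = h ∷ l , s≤s z≤n ∷ pos

-- Cylindric partitions

Pair : Set
Pair = List ℕ × List ℕ

maxPart ∣_∣ : Pair → ℕ
maxPart (xs , ys) = hd xs ⊔ hd ys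
∣ xs , ys ∣ = sumList xs + sumList ys

record Cyl₂₂ (Λ : Pair) : Set where
  constructor cyl
  field
    part₁ : IsPartition (proj₁ Λ)
    part₂ : IsPartition (proj₂ Λ)
    1≥2   : ∀ j → part (proj₂ Λ) (2 + j) ≤ part (proj₁ Λ) j
    2≥1   : ∀ j → part (proj₁ Λ) (2 + j) ≤ part (proj₂ Λ) j

-- Profile (3,1): what is left of a Λ in Cyl₂₂ when the first part of its first partition is removed.
record Cyl₃₁ (Λ : Pair) : Set where
  constructor cyl
  field
    part₁ : IsPartition (proj₁ Λ)
    part₂ : IsPartition (proj₂ Λ)
    1≥2   : ∀ j → part (proj₂ Λ) (3 + j) ≤ part (proj₁ Λ) j
    2≥1   : ∀ j → part (proj₁ Λ) (1 + j) ≤ part (proj₂ Λ) j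

-- These pairs arise from `Cyl₃₁` by prepending to the first partition a number at least the largest
-- part. Prepending it to the second partition instead gives profile (4,0), hence the name.
Cyl₄₀ : Pair → Set
Cyl₄₀ (xs , ys) = Cyl₂₂ (xs , ys) × hd ys ≤ hd xs

module Ray₂₂ (c : ℕ) = Ray Cyl₂₂ maxPart ∣_∣ c
module Ray₃₁ (c : ℕ) = Ray Cyl₃₁ maxPart ∣_∣ c
module Ray₄₀ (c : ℕ) = Ray Cyl₄₀ (hd ∘ proj₁) ∣_∣ c

-- Weighted pairs and removal of first parts.

Weighted₂₂ Weighted₄₀ : ℕ → ℕ → Pair → Set
Weighted₂₂ c n Λ = Cyl₂₂ Λ × c * maxPart Λ + ∣ Λ ∣ ≡ n
Weighted₄₀ c n Λ = Cyl₄₀ Λ × c * hd (proj₁ Λ) + ∣ Λ ∣ ≡ n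

addFirst : ℕ × Pair → Pair
addFirst (x , (xs , ys)) = cons x xs , ys

dropFirst : Pair → ℕ × Pair
dropFirst (xs , ys) = hd xs , (tl xs , ys)

cyl-swap : ∀ {Λ} → Cyl₂₂ Λ → Cyl₂₂ (swap Λ)
cyl-swap (cyl p q hi lo) = cyl q p lo hi

cyl-empty : Cyl₂₂ ([] , [])
cyl-empty = cyl ([] , []) ([] , []) (λ _ → z≤n) (λ _ → z≤n)

module _ (c n : ℕ) where

  weighted-40⇒22 : ∀ {Λ} → Weighted₄₀ c n Λ → Weighted₂₂ c n Λ
  weighted-40⇒22 {Λ} ((cy , le) , e) = cy , trans (cong (λ k → c * k + ∣ Λ ∣) (m≥n⇒m⊔n≡m le)) e

  weighted-22⇒40 : ∀ {Λ} → hd (proj₂ Λ) ≤ hd (proj₁ Λ) → Weighted₂₂ c n Λ → Weighted₄₀ c n Λ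
  weighted-22⇒40 {Λ} le (cy , e) = (cy , le) , trans (cong (λ k → c * k + ∣ Λ ∣) (sym (m≥n⇒m⊔n≡m le))) e

  -- As x bounds every part, it can head the first partition and satisfies the new inequality at
  -- index 0. It then counts once in the size and c times as the largest part, hence the coefficient
  -- 1 + c.
  addFirst-40 : ∀ r → Ray₃₁.Ray c n r → Weighted₄₀ c n (addFirst r) × dropFirst (addFirst r) ≡ r
  addFirst-40 (x , (xs , ys)) (cyl p q hi lo , M≤x , e) =
    ((cyl (cons-partition x p xs≤x) q
        (λ { zero → ≤-trans (part≤hd q 2) (≤-trans ys≤x (≤-reflexive (sym (hd-cons x xs))))
           ; (suc j) → ≤-trans (hi j) (≤-reflexive (sym (part-cons x p xs≤x j))) })
        (λ j → ≤-trans (≤-reflexive (part-cons x p xs≤x (suc j))) (lo j))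
     , ≤-trans ys≤x (≤-reflexive (sym (hd-cons x xs))))
    , trans (cong₂ (λ y s → c * y + (s + sumList ys)) (hd-cons x xs) (sum-cons x p xs≤x))
        (trans (sym (weight-addFirst c x (sumList xs) (sumList ys))) e))
    , cong₂ (λ y zs → y , (zs , ys)) (hd-cons x xs) (tl-cons x p xs≤x)
    where
    xs≤x = ≤-trans (m≤m⊔n (hd xs) (hd ys)) M≤x
    ys≤x = ≤-trans (m≤n⊔m (hd xs) (hd ys)) M≤x

  dropFirst-40 : ∀ Λ → Weighted₄₀ c n Λ → Ray₃₁.Ray c n (dropFirst Λ) × addFirst (dropFirst Λ) ≡ Λ
  dropFirst-40 (xs , ys) ((cyl p q hi lo , h) , e) =
    (cyl (tl-partition p) q
       (λ j → ≤-trans (hi (suc j)) (≤-reflexive (sym (part-tl xs j))))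
       (λ j → ≤-trans (≤-reflexive (part-tl xs (suc j))) (lo j))
    , ⊔-lub (hd-tl p) h
    , trans (weight-addFirst c (hd xs) (sumList (tl xs)) (sumList ys))
        (trans (cong (λ s → c * hd xs + (s + sumList ys)) (sym (sum-hd-tl xs))) e))
    , cong (λ zs → zs , ys) (cons-hd-tl p)

  card-40 : ∀ {z} → HasCard (Ray₃₁.Ray c n) z → HasCard (Weighted₄₀ c n) z
  card-40 = card-map addFirst dropFirst addFirst-40 dropFirst-40

  -- Here the largest part heads the second partition. Removing it turns profile (3,1) into (2,2),
  -- and its contribution to the size raises the coefficient from 1 + c to 2 + c.
  card-edge-≤ : ∀ {z} → HasCard (Ray₂₂.Ray (1 + c) n) z →
                HasCard (λ Λ → Ray₃₁.Edge c n Λ × hd (proj₁ Λ) ≤ hd (proj₂ Λ)) z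
  card-edge-≤ = card-map (λ (m , (xs , ys)) → xs , cons m ys) (λ (xs , ys) → hd ys , (xs , tl ys))
    (λ { (m , (xs , ys)) (cyl p q hi lo , M≤m , e) →
      let xs≤m = ≤-trans (m≤m⊔n (hd xs) (hd ys)) M≤m
          ys≤m = ≤-trans (m≤n⊔m (hd xs) (hd ys)) M≤m
          xs≤hd = ≤-trans xs≤m (≤-reflexive (sym (hd-cons m ys)))
      in ((cyl p (cons-partition m q ys≤m)
             (λ j → ≤-trans (≤-reflexive (part-cons m q ys≤m (2 + j))) (hi j))
             (λ { zero → ≤-trans (part≤hd p 1) xs≤hd
                ; (suc j) → ≤-trans (lo j) (≤-reflexive (sym (part-cons m q ys≤m j))) })
          , trans (cong₂ (λ k s → suc c * k + (sumList xs + s))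
              (trans (m≤n⇒m⊔n≡n xs≤hd) (hd-cons m ys)) (sum-cons m q ys≤m))
              (trans (sym (weight-edge-≤ c m (sumList xs) (sumList ys))) e))
         , xs≤hd)
         , cong₂ (λ k zs → k , (xs , zs)) (hd-cons m ys) (tl-cons m q ys≤m) })
    (λ { (xs , ys) ((cyl p q hi lo , e) , h) →
      (cyl p (tl-partition q)
         (λ j → ≤-trans (≤-reflexive (part-tl ys (2 + j))) (hi j))
         (λ j → ≤-trans (lo (suc j)) (≤-reflexive (sym (part-tl ys j))))
      , ⊔-lub h (hd-tl q)
      , trans (weight-edge-≤ c (hd ys) (sumList xs) (sumList (tl ys)))
          (trans (cong₂ (λ k s → suc c * k + (sumList xs + s)) (sym (m≤n⇒m⊔n≡n h)) (sym (sum-hd-tl ys))) e))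
      , cong (λ zs → xs , zs) (cons-hd-tl q) })

  -- The first part of xs is recorded as m, and the smaller first part of ys takes its place.
  card-edge-> : ∀ {z} → HasCard (Ray₄₀.Ray⁺ (1 + c) n) z →
                HasCard (λ Λ → Ray₃₁.Edge c n Λ × hd (proj₂ Λ) < hd (proj₁ Λ)) z
  card-edge-> = card-map (λ (m , (xs , ys)) → cons m (tl xs) , cons (hd xs) ys)
                         (λ (xs , ys) → hd xs , (cons (hd ys) (tl xs) , tl ys))
    (λ { (m , (xs , ys)) ((cyl p q hi lo , h) , xs<m , e) →
      let tp = tl-partition p
          tl≤m = ≤-trans (hd-tl p) (<⇒≤ xs<m)
          lt = ≤-trans (≤-reflexive (cong suc (hd-cons (hd xs) ys))) (≤-trans xs<m (≤-reflexive (sym (hd-cons m (tl xs)))))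
      in ((cyl (cons-partition m tp tl≤m) (cons-partition (hd xs) q h)
             (λ { zero → ≤-trans (≤-reflexive (part-cons (hd xs) q h 2))
                           (≤-trans (hi 0) (≤-trans (<⇒≤ xs<m) (≤-reflexive (sym (hd-cons m (tl xs))))))
                ; (suc j) → ≤-trans (≤-reflexive (part-cons (hd xs) q h (3 + j)))
                           (≤-trans (hi (suc j)) (≤-reflexive (sym (trans (part-cons m tp tl≤m j) (part-tl xs j))))) })
             (λ { zero → ≤-trans (≤-reflexive (trans (part-cons m tp tl≤m 0) (part-tl xs 0)))
                           (≤-trans (part-mono p 0) (≤-reflexive (sym (hd-cons (hd xs) ys))))
                ; (suc j) → ≤-trans (≤-reflexive (trans (part-cons m tp tl≤m (suc j)) (part-tl xs (suc j))))
                           (≤-trans (lo j) (≤-reflexive (sym (part-cons (hd xs) q h j)))) })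
          , trans (cong₂ (λ k s → suc c * k + s)
              (trans (m≥n⇒m⊔n≡m (<⇒≤ lt)) (hd-cons m (tl xs)))
              (cong₂ _+_ (sum-cons m tp tl≤m) (sum-cons (hd xs) q h)))
              (trans (sym (weight-edge-> c m (hd xs) (sumList (tl xs)) (sumList ys)))
                (trans (cong (λ s → (2 + c) * m + (s + sumList ys)) (sym (sum-hd-tl xs))) e)))
         , lt)
         , cong₂ _,_ (hd-cons m (tl xs)) (cong₂ _,_
             (trans (cong₂ cons (hd-cons (hd xs) ys) (tl-cons m tp tl≤m)) (cons-hd-tl p))
             (tl-cons (hd xs) q h)) })
    (λ { (xs , ys) ((cyl p q hi lo , e) , ys<xs) →
      let tp = tl-partition p
          -- Profile (3,1) bounds the second part of `xs` by the first part of `ys`, so the latter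
          -- may head `tl xs`.
          tl≤ys = ≤-trans (≤-reflexive (part-tl xs 0)) (lo 0)
          hd≡ = hd-cons (hd ys) (tl xs)
      in ((cyl (cons-partition (hd ys) tp tl≤ys) (tl-partition q)
             (λ { zero → ≤-trans (≤-reflexive (part-tl ys 2)) (≤-trans (part≤hd q 3) (≤-reflexive (sym hd≡)))
                ; (suc j) → ≤-trans (≤-reflexive (part-tl ys (3 + j)))
                    (≤-trans (hi (suc j)) (≤-reflexive (sym (trans (part-cons (hd ys) tp tl≤ys j) (part-tl xs j))))) })
             (λ j → ≤-trans (≤-reflexive (trans (part-cons (hd ys) tp tl≤ys (suc j)) (part-tl xs (suc j))))
                    (≤-trans (lo (suc j)) (≤-reflexive (sym (part-tl ys j)))))
          , ≤-trans (hd-tl q) (≤-reflexive (sym hd≡)))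
         , ≤-trans (≤-reflexive (cong suc hd≡)) ys<xs
         , trans (cong (λ s → (2 + c) * hd xs + (s + sumList (tl ys))) (sum-cons (hd ys) tp tl≤ys))
             (trans (weight-edge-> c (hd xs) (hd ys) (sumList (tl xs)) (sumList (tl ys)))
             (trans (cong₂ (λ k s → suc c * k + s) (sym (m≥n⇒m⊔n≡m (<⇒≤ ys<xs)))
               (cong₂ _+_ (sym (sum-hd-tl xs)) (sym (sum-hd-tl ys)))) e)))
         , cong₂ _,_
             (trans (cong (cons (hd xs)) (tl-cons (hd ys) tp tl≤ys)) (cons-hd-tl p))
             (trans (cong (λ k → cons k (tl ys)) hd≡) (cons-hd-tl q)) })

  card-edge-all : ∀ {a b} → HasCard (Ray₂₂.Ray (1 + c) n) a → HasCard (Ray₄₀.Ray⁺ (1 + c) n) b →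
                  HasCard (Ray₃₁.Edge c n) (a ℤ.+ b)
  card-edge-all D B = card-⊎
    (λ { {xs , ys} e → [ (λ lt → inj₂ (e , lt)) , (λ le → inj₁ (e , le)) ]′ (<-≤-connex (hd ys) (hd xs)) })
    proj₁ proj₁ (λ (_ , le) (_ , lt) → <⇒≱ lt le)
    (card-edge-≤ D) (card-edge-> B)

  -- After removal of the first part m, the largest remaining part is below m, which gives
  -- `Ray₃₁.Ray⁺`, or equals m. In the latter case only the first partition attains it, since the
  -- second one starts below m; this is the case of `card-edge->`.
  card-> : ∀ {a b} → HasCard (Ray₄₀.Ray⁺ (1 + c) n) a → HasCard (Ray₃₁.Ray⁺ c n) b →
           HasCard (λ Λ → Weighted₂₂ c n Λ × hd (proj₂ Λ) < hd (proj₁ Λ)) (a ℤ.+ b)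
  card-> B R⁺ = card-map addFirst dropFirst
    (λ { r@(x , (xs , ys)) (R , lt) →
         let (weighted , inverse) = addFirst-40 r R
         in (weighted-40⇒22 weighted
            , ≤-trans lt (≤-reflexive (sym (hd-cons x xs)))) , inverse })
    (λ Λ (weighted , lt) →
         let (R , inverse) = dropFirst-40 Λ (weighted-22⇒40 (<⇒≤ lt) weighted)
         in (R , lt) , inverse)
    (card-⊎
      (λ { {m , (xs , ys)} ((cy , M≤m , e) , lt) →
         [ (λ M<m → inj₂ (cy , M<m , e))
         , (λ M≡m → inj₁ (cy , M≡m , e , ≰⇒> (λ le → <⇒≢ lt (trans (sym (m≤n⇒m⊔n≡n le)) M≡m))))
         ]′ (m≤n⇒m<n∨m≡n M≤m) })
      (λ { {m , (xs , ys)} (cy , M≡m , e , lt) →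
         (cy , ≤-reflexive M≡m , e) , ≤-trans lt (≤-trans (m≤m⊔n (hd xs) (hd ys)) (≤-reflexive M≡m)) })
      (λ { {m , (xs , ys)} (cy , M<m , e) → (cy , <⇒≤ M<m , e) , ≤-trans (s≤s (m≤n⊔m (hd xs) (hd ys))) M<m })
      (λ (_ , M≡m , _) (_ , M<m , _) → <⇒≢ M<m M≡m)
      (Ray₃₁.card-edge c n (λ Λ → hd (proj₂ Λ) < hd (proj₁ Λ)) (card-edge-> B))
      R⁺)

  weighted-swap : ∀ {Λ} → Weighted₂₂ c n Λ → Weighted₂₂ c n (swap Λ)
  weighted-swap {xs , ys} (cy , e) = cyl-swap cy ,
    trans (cong₂ (λ k s → c * k + s) (⊔-comm (hd ys) (hd xs)) (+-comm (sumList ys) (sumList xs))) e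

  -- Ties between the first parts go to `Weighted₄₀`. When the second partition starts strictly
  -- higher, the symmetry of profile (2,2) allows swapping the two.
  card-22 : ∀ {a b} → HasCard (Weighted₄₀ c n) a →
            HasCard (λ Λ → Weighted₂₂ c n Λ × hd (proj₂ Λ) < hd (proj₁ Λ)) b →
            HasCard (Weighted₂₂ c n) (a ℤ.+ b)
  card-22 W T = card-⊎
    (λ { {xs , ys} weighted → [ (λ lt → inj₂ (weighted , lt)) , (λ le → inj₁ (weighted-22⇒40 le weighted)) ]′
         (<-≤-connex (hd xs) (hd ys)) })
    weighted-40⇒22
    proj₁
    (λ ((_ , le) , _) (_ , lt) → <⇒≱ lt le)
    W
    (card-map swap swap (λ _ (w , lt) → (weighted-swap w , lt) , refl) (λ _ (w , lt) → (weighted-swap w , lt) , refl) T)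

  -- Induction on the parameter c, starting from weights below c.

  module _ (n<c : n < c) where

    -- A positive largest part would already contribute at least c > n to the weight.
    weighted⇒empty : ∀ {Λ} → Weighted₂₂ c n Λ → Λ ≡ ([] , []) × n ≡ 0
    weighted⇒empty {xs , ys} (cyl p q _ _ , e) with hd xs ⊔ hd ys in max≡
    ... | suc m = ⊥-elim (<⇒≱ n<c (≤-trans (m≤m*n c (suc m)) (≤-trans (m≤m+n (c * suc m) _) (≤-reflexive e))))
    ... | zero with hd≡0 p (n≤0⇒n≡0 (≤-trans (m≤m⊔n (hd xs) (hd ys)) (≤-reflexive max≡)))
                  | hd≡0 q (n≤0⇒n≡0 (≤-trans (m≤n⊔m (hd xs) (hd ys)) (≤-reflexive max≡)))
    ... | refl | refl = refl , trans (sym e) (trans (+-identityʳ (c * 0)) (*-zeroʳ c))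

    card-base : ∀ (W : Pair → Set) → (∀ {Λ} → W Λ → Weighted₂₂ c n Λ) → (n ≡ 0 → W ([] , [])) → HasCard W (one n)
    card-base W W⇒ W[] = go n refl
      where
      go : ∀ k → n ≡ k → HasCard W (one k)
      go zero    n≡0 = card-singleton ([] , []) (W[] n≡0) (λ Λ w → proj₁ (weighted⇒empty (W⇒ w)))
      go (suc k) n≡1+k = card-empty (λ Λ w → 1+n≢0 (trans (sym n≡1+k) (proj₂ (weighted⇒empty (W⇒ w)))))

    zero-weight : n ≡ 0 → c * 0 + 0 ≡ n
    zero-weight n≡0 = trans (+-identityʳ (c * 0)) (trans (*-zeroʳ c) (sym n≡0))

    card-22-base : HasCard (Weighted₂₂ c n) (F₂₂ c n)
    card-22-base = card-≡ (sym (unit≤-F₂₂ c n (<⇒≤ n<c)))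
      (card-base (Weighted₂₂ c n) (λ w → w) (λ n≡0 → cyl-empty , zero-weight n≡0))

    card-40-base : HasCard (Weighted₄₀ c n) (F₄₀ c n)
    card-40-base = card-≡ (sym (unit≤-F₄₀ c n (<⇒≤ n<c)))
      (card-base (Weighted₄₀ c n) weighted-40⇒22
        (λ n≡0 → (cyl-empty , z≤n) , zero-weight n≡0))

-- The number b bounds how far n reaches beyond c. A step raises c by 2 and lowers b by 1, so c + b
-- grows and every k ≤ n stays below it; at b = 0 the base case applies. Both counts are proved
-- together because the recursion for each uses both.
card-weighted : ∀ b c n → n < c + b → HasCard (Weighted₂₂ c n) (F₂₂ c n) × HasCard (Weighted₄₀ c n) (F₄₀ c n)
card-weighted zero    c n n<c+0 = card-22-base c n n<c , card-40-base c n n<c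
  where n<c = ≤-trans n<c+0 (≤-reflexive (+-identityʳ c))
card-weighted (suc b) c n n<c+1+b = W₂₂ , W₄₀ n ≤-refl
  where
  rec : ∀ k → k ≤ n → _
  rec k k≤n = card-weighted b (2 + c) k (s≤s (≤-trans k≤n (≤-trans (n≤1+n n)
    (≤-trans n<c+1+b (≤-reflexive (+-suc c b))))))
  rays₂₂ : ∀ k → k ≤ n → HasCard (Ray₂₂.Ray (1 + c) k) (rayF₂₂ (2 + c) k)
  rays₂₂ = Ray₂₂.card-ray (1 + c) (inv-1⊖q (1 + c) (F₂₂ (2 + c))) (λ k k≤n → proj₁ (rec k k≤n))
  rays⁺₄₀ : ∀ k → k ≤ n → HasCard (Ray₄₀.Ray⁺ (1 + c) k) ((q^ (2 + c) ⊛ rayF₄₀ (2 + c)) k)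
  rays⁺₄₀ k k≤n = Ray₄₀.card-ray⁺ (1 + c) (rayF₄₀ (2 + c)) k (λ j j<k →
    Ray₄₀.card-ray (1 + c) (inv-1⊖q (1 + c) (F₄₀ (2 + c))) (λ i i≤n → proj₂ (rec i i≤n)) j (≤-trans (<⇒≤ j<k) k≤n))
  rays₃₁ : ∀ k → k ≤ n → HasCard (Ray₃₁.Ray c k) (F₄₀ c k)
  rays₃₁ = Ray₃₁.card-ray c (F₄₀-rec c) (λ k k≤n → card-edge-all c k (rays₂₂ k k≤n) (rays⁺₄₀ k k≤n))
  W₄₀ : ∀ k → k ≤ n → HasCard (Weighted₄₀ c k) (F₄₀ c k)
  W₄₀ k k≤n = card-40 c k (rays₃₁ k k≤n)
  W₂₂ : HasCard (Weighted₂₂ c n) (F₂₂ c n)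
  W₂₂ = card-≡ (sym (F₂₂-rec c .at n)) (card-22 c n (W₄₀ n ≤-refl)
    (card-> c n (rays⁺₄₀ n ≤-refl) (Ray₃₁.card-ray⁺ c (F₄₀ c) n (λ k k<n → rays₃₁ k (<⇒≤ k<n)))))

-- Passage to the vector encoding.

toVec : Pair → Vec (List ℕ) 2
toVec (xs , ys) = xs ∷ ys ∷ []

fromVec : Vec (List ℕ) 2 → Pair
fromVec (xs ∷ ys ∷ []) = xs , ys

card-cylindric : ∀ N → HasCard (λ Λ → IsCylindric (2 ∷ 2 ∷ []) Λ × size Λ ≡ N) (rhs N)
card-cylindric N = card-map toVec fromVec
  (λ { (xs , ys) (cyl p q hi lo , e) →
    (((λ { zero → p ; (suc zero) → q })
     , (λ { zero j → subst (λ k → part ys k ≤ part xs j) (+-comm 2 j) (hi j)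
          ; (suc zero) j → subst (λ k → part xs k ≤ part ys j) (+-comm 2 j) (lo j) }))
    , trans (cong (λ k → sumList xs + k) (+-identityʳ (sumList ys))) e) , refl })
  (λ { (xs ∷ ys ∷ []) ((p , h) , e) →
    (cyl (p zero) (p (suc zero))
      (λ j → subst (λ k → part ys k ≤ part xs j) (+-comm j 2) (h zero j))
      (λ j → subst (λ k → part xs k ≤ part ys j) (+-comm j 2) (h (suc zero) j))
    , trans (cong (λ k → sumList xs + k) (sym (+-identityʳ (sumList ys)))) e) , refl })
  -- At c = 0 the weight is just the size, and b = N + 1 is enough for N < 0 + b.
  (card-≡ (F₂₂≈rhs .at N) (proj₁ (card-weighted (suc N) 0 N ≤-refl)))

theorem5p2 : (N : ℕ) →
    ∃[ L ] (Unique L ×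
    ((Λ : Vec (List ℕ) 2) →
    (Λ ∈ L) ⇔ (IsCylindric (2 ∷ 2 ∷ []) Λ × size Λ ≡ N)) ×
    (+ length L ≡ rhs N))
theorem5p2 N = let hasCard L u m e = card-cylindric N in L , u , m , e
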